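{- For $0\le i\le k\le n$, $n\ge1$, we have the identity $$\check\Phi(n,k,i)=\sum_{j=0}^{i}(-1)^j\cdot\binom ij\cdot\check\Phi(n,k-j,0).$$
   Context: A quasi-graded poset $(P,\rho,\bar\zeta)$ consists of a finite poset $P$, a function $\rho:P\to\mathbb N$ with $x<y\Rightarrow\rho(x)<\rho(y)$, and a function $\bar\zeta$ in the incidence algebra of $P$ with $\bar\zeta(x,x)=1$. Write $\rho(x,y)=\rho(y)-\rho(x)$. If $P$ has minimal element $\hat0$ and maximal element $\hat1$, $\hat0<\hat1$, its $\mathbf{ab}$-index is the polynomial in non-commuting variables $\mathbf a,\mathbf b$ $$\Psi(P)=\sum\bar\zeta(x_0,x_1)\cdots\bar\zeta(x_{k-1},x_k)\cdot(\mathbf a-\mathbf b)^{\rho(x_0,x_1)-1}\,\mathbf b\,(\mathbf a-\mathbf b)^{\rho(x_1,x_2)-1}\,\mathbf b\cdots\mathbf b\,(\mathbf a-\mathbf b)^{\rho(x_{k-1},x_k)-1},$$ summed over all chains $\hat0=x_0<x_1<\cdots<x_k=\hat1$. Semisuspension. For $n\ge1$ and a finite simplicial complex $\Delta$ (containing $\emptyset$) with $\dim\Delta<n$, $\mathrm{Semi}(\Delta,n)$ is obtained by embedding $\Delta$ in the boundary of an $n$-ball; its face poset $\mathcal F(\mathrm{Semi}(\Delta,n))$ is the following quasi-graded poset, independent of the embedding: the elements are the faces of $\Delta$ (with $\hat0=\emptyset$) and two further elements $*$ and $\hat1$; $\rho(F)=\dim F+1$, $\rho(*)=n$, $\rho(\hat1)=n+1$;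 faces are ordered by inclusion, every other element is $<\hat1$, and $F<*$ for every face $F$ with $\rho(F)<n$ (faces of dimension $n-1$ are incomparable to $*$); $$\bar\zeta(F,*)=1+(-1)^{n-\rho(F)}\,\widetilde\chi(\mathrm{link}_\Delta(F)),\qquad\widetilde\chi(\mathrm{link}_\Delta(F))=\sum_{H\in\Delta,\,H\supseteq F}(-1)^{\dim H-\dim F-1},$$ and $\bar\zeta=1$ on all other intervals. For $0\le i\le k$, $\Delta_{k,i}$ is the simplicial complex generated by $i+1$ of the facets of the $k$-dimensional simplex (so $\dim\Delta_{k,i}=k-1$, and $\Delta_{0,0}=\{\emptyset\}$). For $0\le i\le k\le n$ let $P_{n,k,i}=\mathcal F(\mathrm{Semi}(\Delta_{k,i},n))$. The $\mathbf{cd}$-indexes of the simplicial shelling components are $\check\Phi(n,k,0)=\Psi(P_{n,k,0})$ and $\check\Phi(n,k,i)=\Psi(P_{n,k,i})-\Psi(P_{n,k,i-1})$ for $1\le i\le k\le n$. -}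

module Defs where

open import Data.Bool.Base using (if_then_else_)
import Data.Bool.Properties as Bool
open import Data.Empty using (⊥-elim)
open import Data.Fin.Base using (Fin; zero; suc)
open import Data.Fin.Properties using (any?)
open import Data.Fin.Subset
  using (Subset; inside; outside; ⁅_⁆; ∁; ∣_∣; Nonempty; _∈_; _⊆_) renaming (⊥ to ∅)
open import Data.Fin.Subset.Properties
  using (_∈?_; _⊆?_; ⊆-refl; ⊆-trans; ⊆-antisym; ⊥⊆; ∣⊥∣≡0; p⊆q⇒∣p∣≤∣q∣; drop-∷-⊆)
open import Data.Integer.Base using (ℤ; 0ℤ; 1ℤ; -1ℤ)
open import Data.List.Base
  using (List; []; _∷_; _++_; map; concatMap; cartesianProductWith; filter; foldr; mapMaybe; upTo)
open import Data.List.Membership.Propositional using () renaming (_∈_ to _∈ˡ_)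
open import Data.List.Membership.Propositional.Properties using (∈-map⁺; ∈-map⁻; ∈-++⁺ˡ; ∈-++⁺ʳ)
import Data.List.Properties as List
open import Data.List.Relation.Unary.All as All using (All; []; _∷_)
import Data.List.Relation.Unary.All.Properties as All
open import Data.List.Relation.Unary.AllPairs using ([]; _∷_)
open import Data.List.Relation.Unary.Any using (here; there)
open import Data.List.Relation.Unary.Unique.Propositional using (Unique)
import Data.List.Relation.Unary.Unique.Propositional.Properties as Unique
open import Data.Maybe.Base using (Maybe; just; nothing)
open import Data.Nat.Base using (ℕ; zero; suc; _∸_; _≤_; _<_; z≤n; s≤s; NonZero; >-nonZero⁻¹)
import Data.Nat.Properties as ℕ
open import Data.Product.Base using (_×_; _,_; ∃)
open import Data.Refinement using (Refinement-syntax; value) renaming (_,_ to _,ʳ_)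
open import Data.Irrelevant using ([_])
open import Data.Vec.Base using ([]; _∷_)
import Data.Vec.Base as Vec
import Data.Vec.Properties as Vec
open import Level using (0ℓ)
open import Relation.Binary.Core using (Rel)
open import Relation.Binary.Definitions using (DecidableEquality; Decidable; Minimum; Maximum)
open import Relation.Binary.Structures using (IsDecPartialOrder)
import Relation.Binary.Construct.NonStrictToStrict as ToStrict
open import Relation.Binary.PropositionalEquality
  using (_≡_; _≢_; refl; sym; cong; subst; isEquivalence)
open import Relation.Nullary.Decidable.Core using (yes; no; does; recompute; map′; _×-dec_)
open import Relation.Nullary.Negation.Core using (¬_; contradiction; contradiction-irr)
open import Relation.Unary as U using (Pred)

import Data.Integer.Base as ℤ

data Letter : Set where
  a b : Letter

_≟ᴸ_ : DecidableEquality Letter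
a ≟ᴸ a = yes refl
a ≟ᴸ b = no λ ()
b ≟ᴸ a = no λ ()
b ≟ᴸ b = yes refl

Word : Set
Word = List Letter

-- Finite formal sums of terms; the same monomial may occur repeatedly, so
-- the equality of polynomials is _≈_ (equality of all coefficients), not _≡_.
ℤ⟨a,b⟩ : Set
ℤ⟨a,b⟩ = List (ℤ × Word)

coeff : ℤ⟨a,b⟩ → Word → ℤ
coeff []            w = 0ℤ
coeff ((c , u) ∷ p) w =
  (if does (List.≡-dec _≟ᴸ_ u w) then c else 0ℤ) ℤ.+ coeff p w

infix  4 _≈_
infixl 6 _+ₚ_ _-ₚ_
infixl 7 _*ₚ_
infixr 7 _·_
infixr 8 _^ₚ_

_≈_ : Rel ℤ⟨a,b⟩ 0ℓ
p ≈ q = ∀ w → coeff p w ≡ coeff q w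

0ₚ 1ₚ 𝐚 𝐛 : ℤ⟨a,b⟩
0ₚ = []
1ₚ = (1ℤ , []) ∷ []
𝐚  = (1ℤ , a ∷ []) ∷ []
𝐛  = (1ℤ , b ∷ []) ∷ []

_+ₚ_ : ℤ⟨a,b⟩ → ℤ⟨a,b⟩ → ℤ⟨a,b⟩
p +ₚ q = p ++ q

_·_ : ℤ → ℤ⟨a,b⟩ → ℤ⟨a,b⟩
c · p = map (λ (d , u) → c ℤ.* d , u) p

_-ₚ_ : ℤ⟨a,b⟩ → ℤ⟨a,b⟩ → ℤ⟨a,b⟩
p -ₚ q = p +ₚ -1ℤ · q

_*ₚ_ : ℤ⟨a,b⟩ → ℤ⟨a,b⟩ → ℤ⟨a,b⟩
_*ₚ_ = cartesianProductWith (λ (c , u) (d , v) → c ℤ.* d , u ++ v)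

_^ₚ_ : ℤ⟨a,b⟩ → ℕ → ℤ⟨a,b⟩
p ^ₚ zero  = 1ₚ
p ^ₚ suc n = p *ₚ p ^ₚ n

∑ : {A : Set} → List A → (A → ℤ⟨a,b⟩) → ℤ⟨a,b⟩
∑ xs f = foldr (λ x p → f x +ₚ p) 0ₚ xs

syntax ∑ xs (λ x → p) = ∑[ x ∈ xs ] p

record QuasiGradedPoset : Set₁ where
  infix 4 _⊑_
  field
    Carrier           : Set
    _⊑_               : Rel Carrier 0ℓ
    isDecPartialOrder : IsDecPartialOrder _≡_ _⊑_
    elements          : List Carrier
    complete          : ∀ x → x ∈ˡ elements
    unique            : Unique elements

  open IsDecPartialOrder isDecPartialOrder public using (_≟_) renaming (_≤?_ to _⊑?_)
  open ToStrict _≡_ _⊑_ public using () renaming (_<_ to _⊏_)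

  _⊏?_ : Decidable _⊏_
  _⊏?_ = ToStrict.<-decidable _≡_ _⊑_ _≟_ _⊑?_

  field
    ρ      : Carrier → ℕ
    ρ-mono : ∀ {x y} → x ⊏ y → ρ x < ρ y
    -- An element of the incidence algebra is a function on the intervals
    -- [x , y], x ⊑ y; the values of ζ̄ at other pairs carry no meaning.
    ζ̄      : Carrier → Carrier → ℤ
    ζ̄-refl : ∀ x → ζ̄ x x ≡ 1ℤ

record Bounded (P : QuasiGradedPoset) : Set where
  open QuasiGradedPoset P
  field
    0̂ 1̂   : Carrier
    0̂-min : Minimum _⊑_ 0̂
    1̂-max : Maximum _⊑_ 1̂
    0̂⊏1̂   : 0̂ ⊏ 1̂

module _ (P : QuasiGradedPoset) where
  open QuasiGradedPoset P

  -- All lists x₁ ∷ ⋯ ∷ xₘ ∷ [] with x ⊏ x₁ ⊏ ⋯ ⊏ xₘ ⊏ y.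
  chains : ℕ → Carrier → Carrier → List (List Carrier)
  chains zero    x y = if does (x ⊏? y) then [] ∷ [] else []
  chains (suc m) x y =
    concatMap (λ z → map (z ∷_) (chains m z y)) (filter (x ⊏?_) elements)

  link-weight : Carrier → Carrier → ℤ⟨a,b⟩
  link-weight x y = ζ̄ x y · (𝐚 -ₚ 𝐛) ^ₚ (ρ y ∸ ρ x ∸ 1)

  weight : Carrier → List Carrier → Carrier → ℤ⟨a,b⟩
  weight x []       y = link-weight x y
  weight x (z ∷ zs) y = link-weight x z *ₚ 𝐛 *ₚ weight z zs y

  -- Since ρ is strictly increasing, a chain from 0̂ to 1̂ has fewer than
  -- ρ 1̂ ∸ ρ 0̂ interior elements, so this is the sum over all chains.
  Ψ : Bounded P → ℤ⟨a,b⟩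
  Ψ B = ∑[ m ∈ upTo (ρ 1̂ ∸ ρ 0̂) ] ∑[ xs ∈ chains m 0̂ 1̂ ] weight 0̂ xs 1̂
    where open Bounded B

record SimplicialComplex (v : ℕ) : Set₁ where
  field
    IsFace      : Pred (Subset v) 0ℓ
    isFace?     : U.Decidable IsFace
    ∅-isFace    : IsFace ∅
    down-closed : ∀ {F G} → F ⊆ G → IsFace G → IsFace F

  Face : Set
  Face = [ F ∈ Subset v ∣ IsFace F ]

  ∅-face : Face
  ∅-face = ∅ ,ʳ [ ∅-isFace ]

allSubsets : ∀ v → List (Subset v)
allSubsets zero    = [] ∷ []
allSubsets (suc v) = map (outside ∷_) (allSubsets v) ++ map (inside ∷_) (allSubsets v)

module _ {v : ℕ} (Δ : SimplicialComplex v) where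
  open SimplicialComplex Δ

  toFace : Subset v → Maybe Face
  toFace F with isFace? F
  ... | yes p = just (F ,ʳ [ p ])
  ... | no  _ = nothing

  faces : List Face
  faces = mapMaybe toFace (allSubsets v)

  -- dim F + 1
  rank : Face → ℕ
  rank F = ∣ value F ∣

  -- Each summand is (-1) ^ (dim H - dim F - 1), whose exponent may be -1;
  -- the exponent used here has the same parity.
  χ̃-link : Face → ℤ
  χ̃-link F = foldr ℤ._+_ 0ℤ
    (map (λ H → -1ℤ ℤ.^ suc (rank H ∸ rank F))
         (filter (λ H → value F ⊆? value H) faces))

-- As rank is dim + 1, this is dim Δ < n.
Dim<_ : ℕ → ∀ {v} → SimplicialComplex v → Set
(Dim< n) Δ = ∀ F → rank Δ F ≤ n

∈-allSubsets : ∀ {v} (F : Subset v) → F ∈ˡ allSubsets v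
∈-allSubsets []            = here refl
∈-allSubsets (outside ∷ F) = ∈-++⁺ˡ (∈-map⁺ (outside ∷_) (∈-allSubsets F))
∈-allSubsets (inside  ∷ F) =
  ∈-++⁺ʳ (map (outside ∷_) (allSubsets _)) (∈-map⁺ (inside ∷_) (∈-allSubsets F))

allSubsets-unique : ∀ v → Unique (allSubsets v)
allSubsets-unique zero    = [] ∷ []
allSubsets-unique (suc v) = Unique.++⁺
  (Unique.map⁺ (λ { refl → refl }) (allSubsets-unique v))
  (Unique.map⁺ (λ { refl → refl }) (allSubsets-unique v))
  λ (p , q) → disjoint (∈-map⁻ _ p) (∈-map⁻ _ q)
  where
  disjoint : ∀ {F : Subset (suc v)} {xs ys : List (Subset v)} →
             (∃ λ G → G ∈ˡ xs × F ≡ outside ∷ G) →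
             ¬ (∃ λ H → H ∈ˡ ys × F ≡ inside ∷ H)
  disjoint (_ , _ , refl) (_ , _ , ())

module _ {v : ℕ} (Δ : SimplicialComplex v) where
  open SimplicialComplex Δ

  private
    complete-aux : (F : Face) (xs : List (Subset v)) → value F ∈ˡ xs →
                   F ∈ˡ mapMaybe (toFace Δ) xs
    complete-aux (F ,ʳ [ p ]) (.F ∷ xs) (here refl) with isFace? F
    ... | yes _  = here refl
    ... | no  ¬p = contradiction-irr p ¬p
    complete-aux F (G ∷ xs) (there F∈xs) with isFace? G
    ... | yes _ = there (complete-aux F xs F∈xs)
    ... | no  _ = complete-aux F xs F∈xs

    fresh-aux : (G : Subset v) .(p : IsFace G) (xs : List (Subset v)) → All (G ≢_) xs →
                All ((G ,ʳ [ p ]) ≢_) (mapMaybe (toFace Δ) xs)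
    fresh-aux G p []       []           = []
    fresh-aux G p (H ∷ xs) (G≢H ∷ G∉xs) with isFace? H
    ... | yes _ = (λ eq → G≢H (cong value eq)) ∷ fresh-aux G p xs G∉xs
    ... | no  _ = fresh-aux G p xs G∉xs

    unique-aux : (xs : List (Subset v)) → Unique xs → Unique (mapMaybe (toFace Δ) xs)
    unique-aux []       []             = []
    unique-aux (G ∷ xs) (G∉xs ∷ xs!) with isFace? G
    ... | yes p = fresh-aux G p xs G∉xs ∷ unique-aux xs xs!
    ... | no  _ = unique-aux xs xs!

  ∈-faces : ∀ F → F ∈ˡ faces Δ
  ∈-faces F = complete-aux F (allSubsets v) (∈-allSubsets (value F))

  faces-unique : Unique (faces Δ)
  faces-unique = unique-aux (allSubsets v) (allSubsets-unique v)

⊆∧∣∣≡⇒≡ : ∀ {v} (F G : Subset v) → F ⊆ G → ∣ F ∣ ≡ ∣ G ∣ → F ≡ G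
⊆∧∣∣≡⇒≡ []            []            _   _  = refl
⊆∧∣∣≡⇒≡ (outside ∷ F) (outside ∷ G) F⊆G eq =
  cong (outside ∷_) (⊆∧∣∣≡⇒≡ F G (drop-∷-⊆ F⊆G) eq)
⊆∧∣∣≡⇒≡ (outside ∷ F) (inside  ∷ G) F⊆G eq =
  ⊥-elim (ℕ.1+n≰n (subst (_≤ ∣ G ∣) eq (p⊆q⇒∣p∣≤∣q∣ (drop-∷-⊆ F⊆G))))
⊆∧∣∣≡⇒≡ (inside  ∷ F) (outside ∷ G) F⊆G eq with F⊆G Vec.here
... | ()
⊆∧∣∣≡⇒≡ (inside  ∷ F) (inside  ∷ G) F⊆G eq =
  cong (inside ∷_) (⊆∧∣∣≡⇒≡ F G (drop-∷-⊆ F⊆G) (ℕ.suc-injective eq))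

module Semisuspension {v : ℕ} (Δ : SimplicialComplex v) (n : ℕ) (dim<n : (Dim< n) Δ) where
  open SimplicialComplex Δ

  data Element : Set where
    face : Face → Element
    ∗    : Element
    top  : Element

  infix 4 _≼_

  data _≼_ : Rel Element 0ℓ where
    face≼face : ∀ {F G} → value F ⊆ value G → face F ≼ face G
    face≼∗    : ∀ {F} → rank Δ F < n → face F ≼ ∗
    ∗≼∗       : ∗ ≼ ∗
    ≼top      : ∀ {x} → x ≼ top

  rk : Element → ℕ
  rk (face F) = rank Δ F
  rk ∗        = n
  rk top      = suc n

  ζ : Element → Element → ℤ
  ζ (face F) ∗ = 1ℤ ℤ.+ -1ℤ ℤ.^ (n ∸ rank Δ F) ℤ.* χ̃-link Δ F
  ζ _        _ = 1ℤ

  value-injective : {F G : Face} → value F ≡ value G → F ≡ G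
  value-injective {_ ,ʳ _} {_ ,ʳ _} refl = refl

  _≟ᴱ_ : DecidableEquality Element
  face F ≟ᴱ face G = map′ (λ eq → cong face (value-injective eq)) (λ { refl → refl })
                          (Vec.≡-dec Bool._≟_ (value F) (value G))
  face _ ≟ᴱ ∗      = no λ ()
  face _ ≟ᴱ top    = no λ ()
  ∗      ≟ᴱ face _ = no λ ()
  ∗      ≟ᴱ ∗      = yes refl
  ∗      ≟ᴱ top    = no λ ()
  top    ≟ᴱ face _ = no λ ()
  top    ≟ᴱ ∗      = no λ ()
  top    ≟ᴱ top    = yes refl

  _≼?_ : Decidable _≼_
  face F ≼? face G = map′ face≼face (λ { (face≼face p) → p }) (value F ⊆? value G)
  face F ≼? ∗      = map′ face≼∗ (λ { (face≼∗ p) → p }) (rank Δ F ℕ.<? n)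
  ∗      ≼? face _ = no λ ()
  ∗      ≼? ∗      = yes ∗≼∗
  top    ≼? face _ = no λ ()
  top    ≼? ∗      = no λ ()
  _      ≼? top    = yes ≼top

  ≼-refl : ∀ {x} → x ≼ x
  ≼-refl {face _} = face≼face ⊆-refl
  ≼-refl {∗}      = ∗≼∗
  ≼-refl {top}    = ≼top

  ≼-trans : ∀ {x y z} → x ≼ y → y ≼ z → x ≼ z
  ≼-trans (face≼face p) (face≼face q) = face≼face (⊆-trans p q)
  ≼-trans (face≼face p) (face≼∗ q)    = face≼∗ (ℕ.≤-<-trans (p⊆q⇒∣p∣≤∣q∣ p) q)
  ≼-trans (face≼∗ p)    ∗≼∗           = face≼∗ p
  ≼-trans ∗≼∗           ∗≼∗           = ∗≼∗
  ≼-trans _             ≼top          = ≼top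

  ≼-antisym : ∀ {x y} → x ≼ y → y ≼ x → x ≡ y
  ≼-antisym (face≼face p) (face≼face q) = cong face (value-injective (⊆-antisym p q))
  ≼-antisym ∗≼∗           ∗≼∗           = refl
  ≼-antisym ≼top          ≼top          = refl

  ≼-isDecPartialOrder : IsDecPartialOrder _≡_ _≼_
  ≼-isDecPartialOrder = record
    { isPartialOrder = record
      { isPreorder = record
        { isEquivalence = isEquivalence
        ; reflexive     = λ { refl → ≼-refl }
        ; trans         = ≼-trans
        }
      ; antisym = ≼-antisym
      }
    ; _≟_  = _≟ᴱ_
    ; _≤?_ = _≼?_
    }

  elems : List Element
  elems = ∗ ∷ top ∷ map face (faces Δ)

  ∈-elems : ∀ x → x ∈ˡ elems
  ∈-elems (face F) = there (there (∈-map⁺ face (∈-faces Δ F)))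
  ∈-elems ∗        = here refl
  ∈-elems top      = there (here refl)

  elems-unique : Unique elems
  elems-unique =
    ((λ ()) ∷ All.map⁺ (All.universal (λ _ ()) _)) ∷
    All.map⁺ (All.universal (λ _ ()) _) ∷
    Unique.map⁺ (λ { refl → refl }) (faces-unique Δ)

  rk-mono : ∀ {x y} → x ≼ y × x ≢ y → rk x < rk y
  rk-mono {face F} {face G} (face≼face p , x≢y) = ℕ.≤∧≢⇒< (p⊆q⇒∣p∣≤∣q∣ p)
    λ eq → x≢y (cong face (value-injective (⊆∧∣∣≡⇒≡ (value F) (value G) p eq)))
  rk-mono (face≼∗ p , _) = p
  rk-mono (∗≼∗ , x≢y) = contradiction refl x≢y
  rk-mono {face F} (≼top , _) = s≤s (dim<n F)
  rk-mono {∗} (≼top , _) = ℕ.≤-refl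
  rk-mono {top} (≼top , x≢y) = contradiction refl x≢y

  ζ-refl : ∀ x → ζ x x ≡ 1ℤ
  ζ-refl (face _) = refl
  ζ-refl ∗        = refl
  ζ-refl top      = refl

  facePoset : QuasiGradedPoset
  facePoset = record
    { Carrier           = Element
    ; _⊑_               = _≼_
    ; isDecPartialOrder = ≼-isDecPartialOrder
    ; elements          = elems
    ; complete          = ∈-elems
    ; unique            = elems-unique
    ; ρ                 = rk
    ; ρ-mono            = rk-mono
    ; ζ̄                 = ζ
    ; ζ̄-refl            = ζ-refl
    }

  -- For n = 0 the faces are incomparable to ∗, so there is no minimum.
  bounded : .{{NonZero n}} → Bounded facePoset
  bounded = record
    { 0̂     = face ∅-face
    ; 1̂     = top
    ; 0̂-min = min
    ; 1̂-max = λ _ → ≼top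
    ; 0̂⊏1̂   = ≼top , λ ()
    }
    where
    min : Minimum _≼_ (face ∅-face)
    min (face _) = face≼face ⊥⊆
    min ∗        = face≼∗ (subst (_< n) (sym (∣⊥∣≡0 v)) (>-nonZero⁻¹ n))
    min top      = ≼top

-- The k-dimensional simplex has vertex set Fin (suc k); this is its facet
-- opposite the vertex u.
facet : ∀ {k} → Fin (suc k) → Subset (suc k)
facet u = ∁ ⁅ u ⁆

generatedBy : ∀ {k} (A : Subset (suc k)) → Nonempty A → SimplicialComplex (suc k)
generatedBy A (u , u∈A) = record
  { IsFace      = λ F → ∃ λ u → u ∈ A × F ⊆ facet u
  ; isFace?     = λ F → any? λ u → u ∈? A ×-dec F ⊆? facet u
  ; ∅-isFace    = u , u∈A , ⊥⊆
  ; down-closed = λ F⊆G (u , u∈A , G⊆) → u , u∈A , ⊆-trans F⊆G G⊆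
  }

-- An arbitrary choice, for all i ≤ k, of i + 1 facets of the k-simplex,
-- given by their opposite vertices. All choices yield isomorphic Δ_{k,i}.
record FacetSelection : Set where
  field
    select : ∀ k → ℕ → Subset (suc k)
    size   : ∀ {k i} → i ≤ k → ∣ select k i ∣ ≡ suc i

initial : ∀ v → ℕ → Subset v
initial zero    _       = []
initial (suc v) zero    = ∅
initial (suc v) (suc i) = inside ∷ initial v i

∣initial∣ : ∀ {v i} → i ≤ v → ∣ initial v i ∣ ≡ i
∣initial∣ {zero}  z≤n       = refl
∣initial∣ {suc v} z≤n       = ∣⊥∣≡0 (suc v)
∣initial∣         (s≤s i≤v) = cong suc (∣initial∣ i≤v)

initialFacets : FacetSelection
initialFacets = record
  { select = λ k i → initial (suc k) (suc i)
  ; size   = λ i≤k → ∣initial∣ (s≤s i≤k)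
  }

∣∣≡suc⇒Nonempty : ∀ {v i} (A : Subset v) → ∣ A ∣ ≡ suc i → Nonempty A
∣∣≡suc⇒Nonempty (inside  ∷ A) _  = zero , Vec.here
∣∣≡suc⇒Nonempty (outside ∷ A) eq with ∣∣≡suc⇒Nonempty A eq
... | u , u∈A = suc u , Vec.there u∈A

∣facet∣ : ∀ {k} (u : Fin (suc k)) → ∣ facet u ∣ ≡ k
∣facet∣ {k} zero = ∣∁∅∣ k
  where
  ∣∁∅∣ : ∀ v → ∣ ∁ (∅ {v}) ∣ ≡ v
  ∣∁∅∣ zero    = refl
  ∣∁∅∣ (suc v) = cong suc (∣∁∅∣ v)
∣facet∣ {suc k} (suc u) = cong suc (∣facet∣ u)

module _ (S : FacetSelection) where
  open FacetSelection S

  Δ[_,_] : ∀ k i → i ≤ k → SimplicialComplex (suc k)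
  Δ[ k , i ] i≤k = generatedBy (select k i) (∣∣≡suc⇒Nonempty (select k i) (size i≤k))

  Δ-dim : ∀ {n k i} (i≤k : i ≤ k) → k ≤ n → (Dim< n) (Δ[ k , i ] i≤k)
  Δ-dim {n} {k} i≤k k≤n (F ,ʳ [ p ]) = ℕ.≤-trans (recompute (∣ F ∣ ℕ.≤? k) (bound p)) k≤n
    where
    bound : (∃ λ u → u ∈ select k _ × F ⊆ facet u) → ∣ F ∣ ≤ k
    bound (u , _ , F⊆) = subst (∣ F ∣ ≤_) (∣facet∣ u) (p⊆q⇒∣p∣≤∣q∣ F⊆)

  P : ∀ n k i → i ≤ k → k ≤ n → QuasiGradedPoset
  P n k i i≤k k≤n = Semisuspension.facePoset (Δ[ k , i ] i≤k) n (Δ-dim i≤k k≤n)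

  ΨP : ∀ n .{{_ : NonZero n}} k i → i ≤ k → k ≤ n → ℤ⟨a,b⟩
  ΨP n k i i≤k k≤n =
    Ψ (P n k i i≤k k≤n) (Semisuspension.bounded (Δ[ k , i ] i≤k) n (Δ-dim i≤k k≤n))

  -- The cd-index of a simplicial shelling component, expressed in a and b
  -- (c = a + b, d = ab + ba).
  Φ̌ : ∀ n .{{_ : NonZero n}} k i → i ≤ k → k ≤ n → ℤ⟨a,b⟩
  Φ̌ n k zero    i≤k k≤n = ΨP n k 0 i≤k k≤n
  Φ̌ n k (suc i) i≤k k≤n =
    ΨP n k (suc i) i≤k k≤n -ₚ ΨP n k i (ℕ.≤-trans (ℕ.n≤1+n i) i≤k) k≤n

{-# OPTIONS --safe #-}
-- Grouping the chains of the face poset of Semi(Δ, n) by the largest face they meet, and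
-- expanding each χ̃(link F) as a sum over the faces above F, writes Ψ as a sum over the faces
-- H of Δ of a weight depending only on n and |H|: in this form it is a valuation in Δ. A face
-- of Δ_{k,i} is a set not containing the i + 1 selected vertices, so Φ̌(n,k,i) is the sum of
-- the weights of the subsets of k + 1 points that contain i given points and avoid another
-- one. With β(m,s) the weight of the sets consisting of s fixed points and any of m others,
-- Φ̌(n,k,i) = β(k-i,i), and the identity is the i-fold iterate of β(m,s+1) = β(m+1,s) - β(m,s).

module Submission where

open import Defs
open import Data.Nat.Base using (ℕ; suc; _∸_; _≤_; z≤n; NonZero)
open import Data.Nat.Properties using (≤-trans; m∸n≤m)
open import Data.Nat.Combinatorics using (_C_)
open import Data.Integer.Base using (+_; -1ℤ; _*_; _^_)
open import Data.List.Base using (upTo)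

open import Data.Bool.Base using (Bool; true; false; not; if_then_else_; _∧_)
import Data.Bool.Properties as Bool
open import Data.Fin.Subset
  using (Subset; inside; outside; _∈_; _⊆_; ⊤) renaming (⊥ to ∅; ∣_∣ to card)
open import Data.Fin.Subset.Properties
  using (_∈?_; _⊆?_; ⊆-refl; ⊥⊆; ⊆⊤; ∣⊥∣≡0; ∣⊤∣≡n; p⊆q⇒∣p∣≤∣q∣;
         x∈⁅x⁆; x∈⁅y⁆⇒x≡y; x∈∁p⇒x∉p; x∉p⇒x∈∁p)
open import Data.Integer.Base using (ℤ; 0ℤ; 1ℤ; _+_; _-_; -_)
import Data.Integer.Properties as ℤ
open import Data.Integer.Tactic.RingSolver using (solve-∀)
open import Data.Irrelevant using ([_])
open import Data.List.Base
  using (List; []; _∷_; _++_; map; concatMap; filter; foldr; mapMaybe; applyUpTo; _∷ʳ_)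
import Data.List.Properties as List
import Data.Nat.Base as ℕ
open import Data.Nat.Base using (zero)
open import Data.Nat.Combinatorics using (nCk+nC[k+1]≡[n+1]C[k+1]; k>n⇒nCk≡0)
import Data.Nat.Properties as ℕ
open import Data.Product.Base using (_×_; _,_)
open import Data.Refinement using (value) renaming (_,_ to _,ʳ_)
open import Data.Vec.Base using ([]; _∷_)
import Data.Vec.Properties as Vec
open import Function.Base using (_∘_)
open import Function.Bundles using (mk⇔)
open import Level using (0ℓ)
open import Relation.Binary.PropositionalEquality
  using (_≡_; refl; sym; trans; cong; cong₂; subst; module ≡-Reasoning)
open import Relation.Nullary.Decidable
  using (Dec; yes; no; does; dec-true; dec-false; decidable-stable; does-⇔; ¬?)
open import Relation.Nullary.Negation using (contradiction-irr; ¬_)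
open import Relation.Unary using (Pred; Decidable)

open ≡-Reasoning

private
  variable
    A B : Set

-- Guarded integers and finite integer sums.

infixr 8 ⟦_⟧_

⟦_⟧_ : Bool → ℤ → ℤ
⟦ c ⟧ x = if c then x else 0ℤ

Σ : List A → (A → ℤ) → ℤ
Σ []       f = 0ℤ
Σ (x ∷ xs) f = f x + Σ xs f

⟦⟧-cong : ∀ c {x y} → (c ≡ true → x ≡ y) → ⟦ c ⟧ x ≡ ⟦ c ⟧ y
⟦⟧-cong true  eq = eq refl
⟦⟧-cong false eq = refl

⟦⟧-zero : ∀ c → ⟦ c ⟧ 0ℤ ≡ 0ℤ
⟦⟧-zero true  = refl
⟦⟧-zero false = refl

⟦⟧-+ : ∀ c x y → ⟦ c ⟧ (x + y) ≡ ⟦ c ⟧ x + ⟦ c ⟧ y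
⟦⟧-+ true  x y = refl
⟦⟧-+ false x y = refl

⟦⟧-*ˡ : ∀ c x y → x * ⟦ c ⟧ y ≡ ⟦ c ⟧ (x * y)
⟦⟧-*ˡ true  x y = refl
⟦⟧-*ˡ false x y = ℤ.*-zeroʳ x

Σ-cong : ∀ (xs : List A) {f g : A → ℤ} → (∀ x → f x ≡ g x) → Σ xs f ≡ Σ xs g
Σ-cong []       eq = refl
Σ-cong (x ∷ xs) eq = cong₂ _+_ (eq x) (Σ-cong xs eq)

Σ-zero : ∀ (xs : List A) → Σ xs (λ _ → 0ℤ) ≡ 0ℤ
Σ-zero []       = refl
Σ-zero (x ∷ xs) = trans (ℤ.+-identityˡ _) (Σ-zero xs)

Σ-+ : ∀ (xs : List A) (f g : A → ℤ) → Σ xs (λ x → f x + g x) ≡ Σ xs f + Σ xs g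
Σ-+ []       f g = refl
Σ-+ (x ∷ xs) f g rewrite Σ-+ xs f g = interchange (f x) (g x) (Σ xs f) (Σ xs g)
  where
  interchange : ∀ p q r s → p + q + (r + s) ≡ p + r + (q + s)
  interchange = solve-∀

Σ-* : ∀ (xs : List A) c (f : A → ℤ) → Σ xs (λ x → c * f x) ≡ c * Σ xs f
Σ-* []       c f = sym (ℤ.*-zeroʳ c)
Σ-* (x ∷ xs) c f = trans (cong (λ s → c * f x + s) (Σ-* xs c f)) (sym (ℤ.*-distribˡ-+ c _ _))

Σ-neg : ∀ (xs : List A) (f : A → ℤ) → Σ xs (λ x → - f x) ≡ - Σ xs f
Σ-neg []       f = refl
Σ-neg (x ∷ xs) f = trans (cong (λ s → - f x + s) (Σ-neg xs f)) (sym (ℤ.neg-distrib-+ (f x) _))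

Σ-⟦⟧ : ∀ (xs : List A) c (f : A → ℤ) → Σ xs (λ x → ⟦ c ⟧ f x) ≡ ⟦ c ⟧ Σ xs f
Σ-⟦⟧ xs true  f = refl
Σ-⟦⟧ xs false f = Σ-zero xs

Σ-++ : ∀ (xs ys : List A) (f : A → ℤ) → Σ (xs ++ ys) f ≡ Σ xs f + Σ ys f
Σ-++ []       ys f = sym (ℤ.+-identityˡ _)
Σ-++ (x ∷ xs) ys f = trans (cong (λ s → f x + s) (Σ-++ xs ys f)) (sym (ℤ.+-assoc (f x) _ _))

Σ-map : ∀ (g : A → B) (xs : List A) (f : B → ℤ) → Σ (map g xs) f ≡ Σ xs (f ∘ g)
Σ-map g []       f = refl
Σ-map g (x ∷ xs) f = cong (λ s → f (g x) + s) (Σ-map g xs f)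

Σ-concatMap : ∀ (g : A → List B) (xs : List A) (f : B → ℤ) →
              Σ (concatMap g xs) f ≡ Σ xs (λ x → Σ (g x) f)
Σ-concatMap g []       f = refl
Σ-concatMap g (x ∷ xs) f =
  trans (Σ-++ (g x) (concatMap g xs) f) (cong (λ s → Σ (g x) f + s) (Σ-concatMap g xs f))

Σ-filter : ∀ {P : Pred A 0ℓ} (P? : Decidable P) (xs : List A) (f : A → ℤ) →
           Σ (filter P? xs) f ≡ Σ xs (λ x → ⟦ does (P? x) ⟧ f x)
Σ-filter P? []       f = refl
Σ-filter P? (x ∷ xs) f with does (P? x)
... | true  = cong (λ s → f x + s) (Σ-filter P? xs f)
... | false = trans (Σ-filter P? xs f) (sym (ℤ.+-identityˡ _))

Σ-swap : ∀ (xs : List A) (ys : List B) (f : A → B → ℤ) →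
         Σ xs (λ x → Σ ys (f x)) ≡ Σ ys (λ y → Σ xs (λ x → f x y))
Σ-swap []       ys f = sym (Σ-zero ys)
Σ-swap (x ∷ xs) ys f =
  trans (cong (λ s → Σ ys (f x) + s) (Σ-swap xs ys f)) (sym (Σ-+ ys (f x) _))

Σ-applyUpTo : ∀ (g : ℕ → A) n (f : A → ℤ) → Σ (applyUpTo g n) f ≡ Σ (upTo n) (f ∘ g)
Σ-applyUpTo g n f = trans (cong (λ xs → Σ xs f) (sym (List.map-upTo g n))) (Σ-map g (upTo n) f)

Σ-upTo-suc : ∀ n (f : ℕ → ℤ) → Σ (upTo (suc n)) f ≡ Σ (upTo n) f + f n
Σ-upTo-suc n f = begin
  Σ (upTo (suc n)) f           ≡⟨ cong (λ xs → Σ xs f) (List.upTo-∷ʳ n) ⟨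
  Σ (upTo n ∷ʳ n) f            ≡⟨ Σ-++ (upTo n) (n ∷ []) f ⟩
  Σ (upTo n) f + (f n + 0ℤ)    ≡⟨ cong (λ s → Σ (upTo n) f + s) (ℤ.+-identityʳ (f n)) ⟩
  Σ (upTo n) f + f n           ∎

Σ-upTo-cons : ∀ n (f : ℕ → ℤ) → Σ (upTo (suc n)) f ≡ f 0 + Σ (upTo n) (f ∘ suc)
Σ-upTo-cons n f = cong (λ s → f 0 + s) (Σ-applyUpTo suc n f)

-- Both ranges on the right stop at `n`: the last value of `f` vanishes, and `h` enters one place
-- late, from index 1 of `g` onwards.
Σ-upTo-shift : ∀ n (f g h : ℕ → ℤ) → g 0 ≡ f 0 → (∀ j → g (suc j) ≡ f (suc j) - h j) → f n ≡ 0ℤ →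
               Σ (upTo (suc n)) g ≡ Σ (upTo n) f - Σ (upTo n) h
Σ-upTo-shift n f g h g0≡f0 g≡f-h fn≡0 = begin
  Σ (upTo (suc n)) g
    ≡⟨ Σ-upTo-cons n g ⟩
  g 0 + Σ (upTo n) (g ∘ suc)
    ≡⟨ cong₂ _+_ g0≡f0 (Σ-cong (upTo n) g≡f-h) ⟩
  f 0 + Σ (upTo n) (λ j → f (suc j) - h j)
    ≡⟨ cong (λ s → f 0 + s) (trans (Σ-+ (upTo n) (f ∘ suc) (-_ ∘ h))
         (cong (λ s → Σ (upTo n) (f ∘ suc) + s) (Σ-neg (upTo n) h))) ⟩
  f 0 + (Σ (upTo n) (f ∘ suc) - Σ (upTo n) h)
    ≡⟨ ℤ.+-assoc (f 0) (Σ (upTo n) (f ∘ suc)) (- Σ (upTo n) h) ⟨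
  f 0 + Σ (upTo n) (f ∘ suc) - Σ (upTo n) h
    ≡⟨ cong (_- Σ (upTo n) h) (Σ-upTo-cons n f) ⟨
  Σ (upTo (suc n)) f - Σ (upTo n) h
    ≡⟨ cong (_- Σ (upTo n) h) (Σ-upTo-suc n f) ⟩
  Σ (upTo n) f + f n - Σ (upTo n) h
    ≡⟨ cong (λ s → Σ (upTo n) f + s - Σ (upTo n) h) fn≡0 ⟩
  Σ (upTo n) f + 0ℤ - Σ (upTo n) h
    ≡⟨ cong (_- Σ (upTo n) h) (ℤ.+-identityʳ (Σ (upTo n) f)) ⟩
  Σ (upTo n) f - Σ (upTo n) h  ∎

-- Alternating binomial sums

alternatingSum : ℕ → (ℕ → ℤ) → ℤ
alternatingSum i t = Σ (upTo (suc i)) (λ j → ((-1ℤ ^ j) * + (i C j)) * t j)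

-- Pascal's rule, with the sign change turning its sum into a difference. The alternating sum is
-- thus an `i`-fold iterated difference of `t`. The boundary term vanishes because `i C suc i` is 0.
alternatingSum-suc : ∀ i t → alternatingSum (suc i) t ≡ alternatingSum i t - alternatingSum i (t ∘ suc)
alternatingSum-suc i t =
  Σ-upTo-shift (suc i) (λ j → c i j * t j) (λ j → c (suc i) j * t j) (λ j → c i j * t (suc j))
    refl pascal last-zero
  where
  c : ℕ → ℕ → ℤ
  c i j = (-1ℤ ^ j) * + (i C j)

  last-zero : c i (suc i) * t (suc i) ≡ 0ℤ
  last-zero rewrite k>n⇒nCk≡0 (ℕ.n<1+n i) | ℤ.*-zeroʳ (-1ℤ ^ suc i) = refl

  expand : ∀ e x y z → (-1ℤ * e) * (x + y) * z ≡ (-1ℤ * e) * y * z - e * x * z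
  expand = solve-∀

  pascal : ∀ j → c (suc i) (suc j) * t (suc j) ≡ c i (suc j) * t (suc j) - c i j * t (suc j)
  pascal j = begin
    (-1ℤ * e) * + (suc i C suc j) * t (suc j)
      ≡⟨ cong (λ x → (-1ℤ * e) * + x * t (suc j)) (nCk+nC[k+1]≡[n+1]C[k+1] i j) ⟨
    (-1ℤ * e) * (+ (i C j) + + (i C suc j)) * t (suc j)
      ≡⟨ expand e (+ (i C j)) (+ (i C suc j)) (t (suc j)) ⟩
    c i (suc j) * t (suc j) - c i j * t (suc j)  ∎
    where
    e = -1ℤ ^ j

-- The number β(m,s), that is, the sum over j of `m C j` times φ(s + j). The recursion decides
-- whether one of the `m` free points is taken, so the recurrence for β holds by computation.
binomialSum : (ℕ → ℤ) → ℕ → ℕ → ℤ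
binomialSum φ zero    s = φ s
binomialSum φ (suc m) s = binomialSum φ m s + binomialSum φ m (suc s)

binomialSum-∘suc : ∀ φ m s → binomialSum (φ ∘ suc) m s ≡ binomialSum φ m (suc s)
binomialSum-∘suc φ zero    s = refl
binomialSum-∘suc φ (suc m) s = cong₂ _+_ (binomialSum-∘suc φ m s) (binomialSum-∘suc φ m (suc s))

-- Induction on `i` with `m` left general: the recurrence writes β(m,i+1) as β(m+1,i) - β(m,i), and
-- the hypothesis applies to both. The second alternating sum is the first with its argument
-- shifted, since `suc m + i ∸ suc j` computes to `m + i ∸ j`.
binomialSum-alternating : ∀ φ i m →
  binomialSum φ m i ≡ alternatingSum i (λ j → binomialSum φ (m ℕ.+ i ∸ j) 0)
binomialSum-alternating φ zero m rewrite ℕ.+-identityʳ m = unit _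
  where
  unit : ∀ x → x ≡ 1ℤ * x + 0ℤ
  unit = solve-∀
binomialSum-alternating φ (suc i) m = begin
  binomialSum φ m (suc i)
    ≡⟨ difference (binomialSum φ m i) (binomialSum φ m (suc i)) ⟩
  binomialSum φ (suc m) i - binomialSum φ m i
    ≡⟨ cong₂ _-_ (binomialSum-alternating φ i (suc m)) (binomialSum-alternating φ i m) ⟩
  alternatingSum i (λ j → binomialSum φ (suc m ℕ.+ i ∸ j) 0) -
  alternatingSum i (λ j → binomialSum φ (m ℕ.+ i ∸ j) 0)
    ≡⟨ alternatingSum-suc i (λ j → binomialSum φ (suc m ℕ.+ i ∸ j) 0) ⟨
  alternatingSum (suc i) (λ j → binomialSum φ (suc m ℕ.+ i ∸ j) 0)
    ≡⟨ cong (λ l → alternatingSum (suc i) (λ j → binomialSum φ (l ∸ j) 0)) (ℕ.+-suc m i) ⟨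
  alternatingSum (suc i) (λ j → binomialSum φ (m ℕ.+ suc i ∸ j) 0)  ∎
  where
  difference : ∀ x y → y ≡ x + y - x
  difference = solve-∀

-- Polynomials acting on coefficient functions by left multiplication

infixr 5 _▷_

-- Left multiplication by the word `u`, seen on coefficients: the coefficient at `w` of the product
-- is the old one at `w` with the prefix `u` stripped, and 0 if `u` is no prefix.
monomialAction : Word → (Word → ℤ) → Word → ℤ
monomialAction []      f w       = f w
monomialAction (x ∷ u) f []      = 0ℤ
monomialAction (x ∷ u) f (y ∷ w) = ⟦ does (x ≟ᴸ y) ⟧ monomialAction u f w

-- Only the left factor is a list of terms; the right one is a coefficient function. Sums of
-- polynomials known only through their coefficients can therefore be multiplied without returning
-- to lists.
_▷_ : ℤ⟨a,b⟩ → (Word → ℤ) → Word → ℤ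
(p ▷ f) w = Σ p (λ (c , u) → c * monomialAction u f w)

monomialAction-cong : ∀ u {f g} → (∀ w → f w ≡ g w) → ∀ w → monomialAction u f w ≡ monomialAction u g w
monomialAction-cong []      eq w       = eq w
monomialAction-cong (x ∷ u) eq []      = refl
monomialAction-cong (x ∷ u) eq (y ∷ w) = cong (⟦ does (x ≟ᴸ y) ⟧_) (monomialAction-cong u eq w)

monomialAction-Σ : ∀ u (xs : List A) (f : A → Word → ℤ) w →
  monomialAction u (λ w → Σ xs (λ x → f x w)) w ≡ Σ xs (λ x → monomialAction u (f x) w)
monomialAction-Σ []      xs f w       = refl
monomialAction-Σ (x ∷ u) xs f []      = sym (Σ-zero xs)
monomialAction-Σ (x ∷ u) xs f (y ∷ w) = trans
  (cong (⟦ does (x ≟ᴸ y) ⟧_) (monomialAction-Σ u xs f w))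
  (sym (Σ-⟦⟧ xs (does (x ≟ᴸ y)) (λ z → monomialAction u (f z) w)))

▷-cong : ∀ p {f g} → (∀ w → f w ≡ g w) → ∀ w → (p ▷ f) w ≡ (p ▷ g) w
▷-cong p eq w = Σ-cong p (λ (c , u) → cong (c *_) (monomialAction-cong u eq w))

▷-Σ : ∀ p (xs : List A) (f : A → Word → ℤ) w →
      (p ▷ (λ w → Σ xs (λ x → f x w))) w ≡ Σ xs (λ x → (p ▷ f x) w)
▷-Σ p xs f w = trans
  (Σ-cong p (λ (c , u) → trans (cong (c *_) (monomialAction-Σ u xs f w))
                               (sym (Σ-* xs c (λ x → monomialAction u (f x) w)))))
  (Σ-swap p xs (λ (c , u) x → c * monomialAction u (f x) w))

▷-zero : ∀ p w → (p ▷ (λ _ → 0ℤ)) w ≡ 0ℤ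
-- The zero function is an empty sum, over an arbitrary index type.
▷-zero p w = ▷-Σ p [] (λ (_ : ℕ) _ → 0ℤ) w

▷-⟦⟧ : ∀ p c f w → (p ▷ (λ w → ⟦ c ⟧ f w)) w ≡ ⟦ c ⟧ (p ▷ f) w
▷-⟦⟧ p true  f w = refl
▷-⟦⟧ p false f w = ▷-zero p w

coeffAt : Word → ℤ × Word → ℤ
coeffAt w (c , u) = ⟦ does (List.≡-dec _≟ᴸ_ u w) ⟧ c

coeff-Σ : ∀ p w → coeff p w ≡ Σ p (coeffAt w)
coeff-Σ []      w = refl
coeff-Σ (t ∷ p) w = cong (λ s → coeffAt w t + s) (coeff-Σ p w)

coeff-+ₚ : ∀ p q w → coeff (p +ₚ q) w ≡ coeff p w + coeff q w
coeff-+ₚ p q w = begin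
  coeff (p ++ q) w                   ≡⟨ coeff-Σ (p ++ q) w ⟩
  Σ (p ++ q) (coeffAt w)             ≡⟨ Σ-++ p q (coeffAt w) ⟩
  Σ p (coeffAt w) + Σ q (coeffAt w)  ≡⟨ cong₂ _+_ (coeff-Σ p w) (coeff-Σ q w) ⟨
  coeff p w + coeff q w              ∎

coeff-· : ∀ c p w → coeff (c · p) w ≡ c * coeff p w
coeff-· c []            w = sym (ℤ.*-zeroʳ c)
coeff-· c ((d , u) ∷ p) w = trans
  (cong₂ _+_ (sym (⟦⟧-*ˡ (does (List.≡-dec _≟ᴸ_ u w)) c d)) (coeff-· c p w))
  (sym (ℤ.*-distribˡ-+ c (⟦ does (List.≡-dec _≟ᴸ_ u w) ⟧ d) (coeff p w)))

coeff--ₚ : ∀ p q w → coeff (p -ₚ q) w ≡ coeff p w - coeff q w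
coeff--ₚ p q w = trans (coeff-+ₚ p (-1ℤ · q) w)
  (cong (λ s → coeff p w + s) (trans (coeff-· -1ℤ q w) (ℤ.-1*i≡-i (coeff q w))))

coeff-∑ : ∀ (xs : List A) (f : A → ℤ⟨a,b⟩) w → coeff (∑ xs f) w ≡ Σ xs (λ x → coeff (f x) w)
coeff-∑ []       f w = refl
coeff-∑ (x ∷ xs) f w = trans (coeff-+ₚ (f x) (∑ xs f) w) (cong (λ s → coeff (f x) w + s) (coeff-∑ xs f w))

coeff-monomial : ∀ c u q w → coeff (map (λ (d , v) → c * d , u ++ v) q) w ≡ c * monomialAction u (coeff q) w
coeff-monomial c u q w = begin
  coeff (map (λ (d , v) → c * d , u ++ v) q) w
    ≡⟨ coeff-Σ (map (λ (d , v) → c * d , u ++ v) q) w ⟩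
  Σ (map (λ (d , v) → c * d , u ++ v) q) (coeffAt w)
    ≡⟨ Σ-map (λ (d , v) → c * d , u ++ v) q (coeffAt w) ⟩
  Σ q (λ (d , v) → coeffAt w (c * d , u ++ v))
    ≡⟨ Σ-cong q (λ (d , v) → trans (sym (⟦⟧-*ˡ (does (List.≡-dec _≟ᴸ_ (u ++ v) w)) c d))
                                   (cong (c *_) (prefix u v w d))) ⟩
  Σ q (λ t → c * monomialAction u (λ w → coeffAt w t) w)
    ≡⟨ Σ-* q c (λ t → monomialAction u (λ w → coeffAt w t) w) ⟩
  c * Σ q (λ t → monomialAction u (λ w → coeffAt w t) w)
    ≡⟨ cong (c *_) (monomialAction-Σ u q (λ t w → coeffAt w t) w) ⟨
  c * monomialAction u (λ w → Σ q (coeffAt w)) w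
    ≡⟨ cong (c *_) (monomialAction-cong u (coeff-Σ q) w) ⟨
  c * monomialAction u (coeff q) w  ∎
  where
  -- The decision of `u ++ v ≡ w` is a conjunction over letters, and `monomialAction` nests the same
  -- tests as guards.
  prefix : ∀ u v w d → coeffAt w (d , u ++ v) ≡ monomialAction u (λ w → coeffAt w (d , v)) w
  prefix []      v w       d = refl
  prefix (x ∷ u) v []      d = refl
  prefix (x ∷ u) v (y ∷ w) d =
    trans (Bool.if-∧ (does (x ≟ᴸ y))) (cong (⟦ does (x ≟ᴸ y) ⟧_) (prefix u v w d))

coeff-*ₚ : ∀ p q w → coeff (p *ₚ q) w ≡ (p ▷ coeff q) w
coeff-*ₚ []            q w = refl
coeff-*ₚ ((c , u) ∷ p) q w = trans
  (coeff-+ₚ (map (λ (d , v) → c * d , u ++ v) q) (p *ₚ q) w)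
  (cong₂ _+_ (coeff-monomial c u q w) (coeff-*ₚ p q w))

-- In `weight` the scalar ζ̄ sits inside the left factor of a product with `𝐛`; this brings it to
-- the front.
·-*ₚ-▷ : ∀ c p q f w → ((c · p) *ₚ q ▷ f) w ≡ c * (p *ₚ q ▷ f) w
·-*ₚ-▷ c []            q f w = sym (ℤ.*-zeroʳ c)
·-*ₚ-▷ c ((d , u) ∷ p) q f w = begin
  ((c · ((d , u) ∷ p)) *ₚ q ▷ f) w
    ≡⟨ Σ-++ (map (λ (e , v) → c * d * e , u ++ v) q) ((c · p) *ₚ q) act ⟩
  Σ (map (λ (e , v) → c * d * e , u ++ v) q) act + ((c · p) *ₚ q ▷ f) w
    ≡⟨ cong₂ _+_ first (·-*ₚ-▷ c p q f w) ⟩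
  c * Σ (map (λ (e , v) → d * e , u ++ v) q) act + c * (p *ₚ q ▷ f) w
    ≡⟨ ℤ.*-distribˡ-+ c _ _ ⟨
  c * (Σ (map (λ (e , v) → d * e , u ++ v) q) act + (p *ₚ q ▷ f) w)
    ≡⟨ cong (c *_) (Σ-++ (map (λ (e , v) → d * e , u ++ v) q) (p *ₚ q) act) ⟨
  c * (((d , u) ∷ p) *ₚ q ▷ f) w  ∎
  where
  act : ℤ × Word → ℤ
  act (e , v) = e * monomialAction v f w

  assoc : ∀ c d e x → c * d * e * x ≡ c * (d * e * x)
  assoc = solve-∀

  first : Σ (map (λ (e , v) → c * d * e , u ++ v) q) act ≡ c * Σ (map (λ (e , v) → d * e , u ++ v) q) act
  first = begin
    Σ (map (λ (e , v) → c * d * e , u ++ v) q) act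
      ≡⟨ Σ-map (λ (e , v) → c * d * e , u ++ v) q act ⟩
    Σ q (λ (e , v) → c * d * e * monomialAction (u ++ v) f w)
      ≡⟨ Σ-cong q (λ (e , v) → assoc c d e (monomialAction (u ++ v) f w)) ⟩
    Σ q (λ (e , v) → c * (d * e * monomialAction (u ++ v) f w))
      ≡⟨ Σ-* q c (λ (e , v) → d * e * monomialAction (u ++ v) f w) ⟩
    c * Σ q (λ (e , v) → d * e * monomialAction (u ++ v) f w)
      ≡⟨ cong (c *_) (Σ-map (λ (e , v) → d * e , u ++ v) q act) ⟨
    c * Σ (map (λ (e , v) → d * e , u ++ v) q) act  ∎

-- Sums over Boolean intervals

-- Turns strictness of an inclusion into a condition on cardinalities, so that `kernel` can be
-- purely numerical.
⊆⇒does-≟ : ∀ {v} {F G : Subset v} → F ⊆ G →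
           does (Vec.≡-dec Bool._≟_ F G) ≡ does (card F ℕ.≟ card G)
⊆⇒does-≟ {F = F} {G} F⊆G = does-⇔
  (mk⇔ (cong card) (⊆∧∣∣≡⇒≡ F G F⊆G)) (Vec.≡-dec Bool._≟_ F G) (card F ℕ.≟ card G)

Σ-allSubsets-suc : ∀ v (φ : Subset (suc v) → ℤ) →
  Σ (allSubsets (suc v)) φ ≡
  Σ (allSubsets v) (φ ∘ (outside ∷_)) + Σ (allSubsets v) (φ ∘ (inside ∷_))
Σ-allSubsets-suc v φ = trans
  (Σ-++ (map (outside ∷_) (allSubsets v)) _ φ)
  (cong₂ _+_ (Σ-map (outside ∷_) (allSubsets v) φ) (Σ-map (inside ∷_) (allSubsets v) φ))

Σ-≡ : ∀ {v} (F : Subset v) (φ : Subset v → ℤ) →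
      Σ (allSubsets v) (λ H → ⟦ does (Vec.≡-dec Bool._≟_ F H) ⟧ φ H) ≡ φ F
Σ-≡ []                    φ = ℤ.+-identityʳ (φ [])
Σ-≡ {suc v} (outside ∷ F) φ = begin
  Σ (allSubsets (suc v)) (λ H → ⟦ does (Vec.≡-dec Bool._≟_ (outside ∷ F) H) ⟧ φ H)
    ≡⟨ Σ-allSubsets-suc v _ ⟩
  Σ (allSubsets v) (λ H → ⟦ does (Vec.≡-dec Bool._≟_ F H) ⟧ φ (outside ∷ H)) + Σ (allSubsets v) (λ _ → 0ℤ)
    ≡⟨ cong₂ _+_ (Σ-≡ F (φ ∘ (outside ∷_))) (Σ-zero (allSubsets v)) ⟩
  φ (outside ∷ F) + 0ℤ
    ≡⟨ ℤ.+-identityʳ _ ⟩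
  φ (outside ∷ F)  ∎
Σ-≡ {suc v} (inside ∷ F) φ = begin
  Σ (allSubsets (suc v)) (λ H → ⟦ does (Vec.≡-dec Bool._≟_ (inside ∷ F) H) ⟧ φ H)
    ≡⟨ Σ-allSubsets-suc v _ ⟩
  Σ (allSubsets v) (λ _ → 0ℤ) + Σ (allSubsets v) (λ H → ⟦ does (Vec.≡-dec Bool._≟_ F H) ⟧ φ (inside ∷ H))
    ≡⟨ cong₂ _+_ (Σ-zero (allSubsets v)) (Σ-≡ F (φ ∘ (inside ∷_))) ⟩
  0ℤ + φ (inside ∷ F)
    ≡⟨ ℤ.+-identityˡ _ ⟩
  φ (inside ∷ F)  ∎

-- Induction on the coordinates. One that lies in `H` but not in `F` is free and contributes one
-- step of the recursion of `binomialSum`; one in both shifts the cardinality; one in `F` alone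
-- makes both sides 0.
Σ-interval : ∀ {v} (F H : Subset v) (φ : ℕ → ℤ) →
  Σ (allSubsets v) (λ G → ⟦ does (F ⊆? G) ⟧ ⟦ does (G ⊆? H) ⟧ φ (card G)) ≡
  ⟦ does (F ⊆? H) ⟧ binomialSum φ (card H ∸ card F) (card F)
Σ-interval [] [] φ = ℤ.+-identityʳ (φ 0)
Σ-interval {suc v} (outside ∷ F) (outside ∷ H) φ = begin
  Σ (allSubsets (suc v)) _
    ≡⟨ Σ-allSubsets-suc v _ ⟩
  Σ (allSubsets v) (λ G → ⟦ does (F ⊆? G) ⟧ ⟦ does (G ⊆? H) ⟧ φ (card G)) +
  Σ (allSubsets v) (λ G → ⟦ does (F ⊆? G) ⟧ 0ℤ)
    ≡⟨ cong₂ _+_ (Σ-interval F H φ)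
                 (trans (Σ-cong (allSubsets v) (λ G → ⟦⟧-zero (does (F ⊆? G)))) (Σ-zero (allSubsets v))) ⟩
  ⟦ does (F ⊆? H) ⟧ binomialSum φ (card H ∸ card F) (card F) + 0ℤ
    ≡⟨ ℤ.+-identityʳ _ ⟩
  ⟦ does (F ⊆? H) ⟧ binomialSum φ (card H ∸ card F) (card F)  ∎
Σ-interval {suc v} (outside ∷ F) (inside ∷ H) φ = begin
  Σ (allSubsets (suc v)) _
    ≡⟨ Σ-allSubsets-suc v _ ⟩
  Σ (allSubsets v) (λ G → ⟦ does (F ⊆? G) ⟧ ⟦ does (G ⊆? H) ⟧ φ (card G)) +
  Σ (allSubsets v) (λ G → ⟦ does (F ⊆? G) ⟧ ⟦ does (G ⊆? H) ⟧ φ (suc (card G)))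
    ≡⟨ cong₂ _+_ (Σ-interval F H φ) (Σ-interval F H (φ ∘ suc)) ⟩
  ⟦ does (F ⊆? H) ⟧ binomialSum φ (card H ∸ card F) (card F) +
  ⟦ does (F ⊆? H) ⟧ binomialSum (φ ∘ suc) (card H ∸ card F) (card F)
    ≡⟨ ⟦⟧-+ (does (F ⊆? H)) _ _ ⟨
  ⟦ does (F ⊆? H) ⟧
    (binomialSum φ (card H ∸ card F) (card F) + binomialSum (φ ∘ suc) (card H ∸ card F) (card F))
    ≡⟨ step ⟩
  ⟦ does (F ⊆? H) ⟧ binomialSum φ (suc (card H) ∸ card F) (card F)  ∎
  where
  step : ⟦ does (F ⊆? H) ⟧
           (binomialSum φ (card H ∸ card F) (card F) + binomialSum (φ ∘ suc) (card H ∸ card F) (card F)) ≡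
         ⟦ does (F ⊆? H) ⟧ binomialSum φ (suc (card H) ∸ card F) (card F)
  step with F ⊆? H
  ... | no  _   = refl
  -- The inclusion gives `card F ≤ card H`, without which the truncated difference need not grow by
  -- one.
  ... | yes F⊆H = trans
    (cong (λ s → binomialSum φ (card H ∸ card F) (card F) + s) (binomialSum-∘suc φ (card H ∸ card F) (card F)))
    (cong (λ m → binomialSum φ m (card F)) (sym (ℕ.+-∸-assoc 1 (p⊆q⇒∣p∣≤∣q∣ F⊆H))))
Σ-interval {suc v} (inside ∷ F) (outside ∷ H) φ = begin
  Σ (allSubsets (suc v)) _
    ≡⟨ Σ-allSubsets-suc v _ ⟩
  Σ (allSubsets v) (λ _ → 0ℤ) + Σ (allSubsets v) (λ G → ⟦ does (F ⊆? G) ⟧ 0ℤ)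
    ≡⟨ cong₂ _+_ (Σ-zero (allSubsets v))
                 (trans (Σ-cong (allSubsets v) (λ G → ⟦⟧-zero (does (F ⊆? G)))) (Σ-zero (allSubsets v))) ⟩
  0ℤ  ∎
Σ-interval {suc v} (inside ∷ F) (inside ∷ H) φ = begin
  Σ (allSubsets (suc v)) _
    ≡⟨ Σ-allSubsets-suc v _ ⟩
  Σ (allSubsets v) (λ _ → 0ℤ) +
  Σ (allSubsets v) (λ G → ⟦ does (F ⊆? G) ⟧ ⟦ does (G ⊆? H) ⟧ φ (suc (card G)))
    ≡⟨ cong₂ _+_ (Σ-zero (allSubsets v)) (Σ-interval F H (φ ∘ suc)) ⟩
  0ℤ + ⟦ does (F ⊆? H) ⟧ binomialSum (φ ∘ suc) (card H ∸ card F) (card F)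
    ≡⟨ ℤ.+-identityˡ _ ⟩
  ⟦ does (F ⊆? H) ⟧ binomialSum (φ ∘ suc) (card H ∸ card F) (card F)
    ≡⟨ cong (⟦ does (F ⊆? H) ⟧_) (binomialSum-∘suc φ (card H ∸ card F) (card F)) ⟩
  ⟦ does (F ⊆? H) ⟧ binomialSum φ (card H ∸ card F) (suc (card F))  ∎

Σ-⊇ : ∀ {v} (A : Subset v) (φ : ℕ → ℤ) →
      Σ (allSubsets v) (λ G → ⟦ does (A ⊆? G) ⟧ φ (card G)) ≡ binomialSum φ (v ∸ card A) (card A)
Σ-⊇ {v} A φ = begin
  Σ (allSubsets v) (λ G → ⟦ does (A ⊆? G) ⟧ φ (card G))
    ≡⟨ Σ-cong (allSubsets v) (λ G → cong (λ c → ⟦ does (A ⊆? G) ⟧ ⟦ c ⟧ φ (card G)) (dec-true (G ⊆? ⊤) ⊆⊤)) ⟨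
  Σ (allSubsets v) (λ G → ⟦ does (A ⊆? G) ⟧ ⟦ does (G ⊆? ⊤) ⟧ φ (card G))
    ≡⟨ Σ-interval A ⊤ φ ⟩
  ⟦ does (A ⊆? ⊤) ⟧ binomialSum φ (card (⊤ {v}) ∸ card A) (card A)
    ≡⟨ cong₂ (λ c m → ⟦ c ⟧ binomialSum φ (m ∸ card A) (card A)) (dec-true (A ⊆? ⊤) ⊆⊤) (∣⊤∣≡n v) ⟩
  binomialSum φ (v ∸ card A) (card A)  ∎

Σ-all : ∀ v (φ : ℕ → ℤ) → Σ (allSubsets v) (φ ∘ card) ≡ binomialSum φ v 0
Σ-all v φ = begin
  Σ (allSubsets v) (φ ∘ card)
    ≡⟨ Σ-cong (allSubsets v) (λ G → cong (λ c → ⟦ c ⟧ φ (card G)) (dec-true (∅ ⊆? G) ⊥⊆)) ⟨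
  Σ (allSubsets v) (λ G → ⟦ does (∅ ⊆? G) ⟧ φ (card G))
    ≡⟨ Σ-⊇ (∅ {v}) φ ⟩
  binomialSum φ (v ∸ card (∅ {v})) (card (∅ {v}))
    ≡⟨ cong (λ m → binomialSum φ (v ∸ m) m) (∣⊥∣≡0 v) ⟩
  binomialSum φ v 0  ∎

-- Chain sums

module _ (Q : QuasiGradedPoset) where
  open QuasiGradedPoset Q

  chainSum : ℕ → Carrier → Carrier → Word → ℤ
  chainSum m x y w = Σ (chains Q m x y) (λ zs → coeff (weight Q x zs y) w)

  -- Splits off the first interior element `z`. By linearity the factor of the step from `x` to `z`
  -- acts on the whole sum over the remaining chains.
  chainSum-suc : ∀ m x y w → chainSum (suc m) x y w ≡
    Σ elements (λ z → ⟦ does (x ⊏? z) ⟧ (link-weight Q x z *ₚ 𝐛 ▷ chainSum m z y) w)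
  chainSum-suc m x y w = begin
    Σ (concatMap (λ z → map (z ∷_) (chains Q m z y)) (filter (x ⊏?_) elements)) chainWeight
      ≡⟨ Σ-concatMap (λ z → map (z ∷_) (chains Q m z y)) (filter (x ⊏?_) elements) chainWeight ⟩
    Σ (filter (x ⊏?_) elements) (λ z → Σ (map (z ∷_) (chains Q m z y)) chainWeight)
      ≡⟨ Σ-filter (x ⊏?_) elements _ ⟩
    Σ elements (λ z → ⟦ does (x ⊏? z) ⟧ Σ (map (z ∷_) (chains Q m z y)) chainWeight)
      ≡⟨ Σ-cong elements (λ z → cong (⟦ does (x ⊏? z) ⟧_) (through z)) ⟩
    Σ elements (λ z → ⟦ does (x ⊏? z) ⟧ (link-weight Q x z *ₚ 𝐛 ▷ chainSum m z y) w)  ∎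
    where
    chainWeight : List Carrier → ℤ
    chainWeight zs = coeff (weight Q x zs y) w

    through : ∀ z → Σ (map (z ∷_) (chains Q m z y)) chainWeight ≡
                    (link-weight Q x z *ₚ 𝐛 ▷ chainSum m z y) w
    through z = begin
      Σ (map (z ∷_) (chains Q m z y)) chainWeight
        ≡⟨ Σ-map (z ∷_) (chains Q m z y) chainWeight ⟩
      Σ (chains Q m z y) (λ zs → coeff (link-weight Q x z *ₚ 𝐛 *ₚ weight Q z zs y) w)
        ≡⟨ Σ-cong (chains Q m z y) (λ zs → coeff-*ₚ (link-weight Q x z *ₚ 𝐛) (weight Q z zs y) w) ⟩
      Σ (chains Q m z y) (λ zs → (link-weight Q x z *ₚ 𝐛 ▷ coeff (weight Q z zs y)) w)
        ≡⟨ ▷-Σ (link-weight Q x z *ₚ 𝐛) (chains Q m z y) (λ zs → coeff (weight Q z zs y)) w ⟨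
      (link-weight Q x z *ₚ 𝐛 ▷ chainSum m z y) w  ∎

  coeff-Ψ : ∀ (Q-bounded : Bounded Q) w → let open Bounded Q-bounded in
            coeff (Ψ Q Q-bounded) w ≡ Σ (upTo (ρ 1̂ ∸ ρ 0̂)) (λ m → chainSum m 0̂ 1̂ w)
  coeff-Ψ Q-bounded w = trans
    (coeff-∑ (upTo (ρ 1̂ ∸ ρ 0̂)) _ w)
    (Σ-cong (upTo (ρ 1̂ ∸ ρ 0̂)) (λ m → coeff-∑ (chains Q m 0̂ 1̂) _ w))
    where open Bounded Q-bounded

-- Semisuspensions

link : ℕ → ℤ⟨a,b⟩
link e = (𝐚 -ₚ 𝐛) ^ₚ e *ₚ 𝐛

-- The chain sum from `∗` to `top`: nothing lies strictly between them, so only `m` equal to 0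
-- contributes. The exponent is left unreduced to match `link-weight`.
afterApex : ℕ → ℕ → Word → ℤ
afterApex n zero    = coeff (1ℤ · (𝐚 -ₚ 𝐛) ^ₚ (suc n ∸ n ∸ 1))
afterApex n (suc m) = λ _ → 0ℤ

-- Passing to the apex costs the factor 1 + (-1)^{n-ρ(F)} χ̃(link F), whose two
-- terms are spread over the faces H ⊇ F: the first is charged to H = F.
apexCoeff : ℕ → ℕ → ℕ → ℤ
apexCoeff n f h = ⟦ does (f ℕ.≟ h) ⟧ 1ℤ + (-1ℤ ^ (n ∸ f)) * (-1ℤ ^ suc (h ∸ f))

-- The contribution of a face of rank h to the sum over the chains with m interior elements that
-- start at a subface of rank f.
mutual
  kernel : ℕ → ℕ → ℕ → ℕ → Word → ℤ
  kernel n zero    f h w = ⟦ does (f ℕ.≟ h) ⟧ coeff (1ℤ · (𝐚 -ₚ 𝐛) ^ₚ (suc n ∸ f ∸ 1)) w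
  kernel n (suc m) f h w =
    ⟦ does (f ℕ.<? n) ⟧ (apexCoeff n f h * (link (n ∸ f ∸ 1) ▷ afterApex n m) w) +
    binomialSum (kernelStep n m f h w) (h ∸ f) f

  -- The chains whose first interior element is a face of rank `g` between ranks `f` and `h`. In
  -- `kernel`, `binomialSum` counts these faces rank by rank; the guard excludes the starting face
  -- itself.
  kernelStep : ℕ → ℕ → ℕ → ℕ → Word → ℕ → ℤ
  kernelStep n m f h w g = ⟦ not (does (f ℕ.≟ g)) ⟧ (link (g ∸ f ∸ 1) ▷ kernel n m g h) w

-- Sums over the faces containing a given face.

module _ {v : ℕ} (Δ : SimplicialComplex v) where
  open SimplicialComplex Δ

  Σ-faces : ∀ (φ : Subset v → ℤ) →
    Σ (faces Δ) (φ ∘ value) ≡ Σ (allSubsets v) (λ F → ⟦ does (isFace? F) ⟧ φ F)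
  Σ-faces φ = Σ-mapMaybe (allSubsets v)
    where
    Σ-mapMaybe : ∀ Fs → Σ (mapMaybe (toFace Δ) Fs) (φ ∘ value) ≡ Σ Fs (λ F → ⟦ does (isFace? F) ⟧ φ F)
    Σ-mapMaybe []       = refl
    Σ-mapMaybe (F ∷ Fs) with isFace? F
    ... | yes _ = cong (λ s → φ F + s) (Σ-mapMaybe Fs)
    ... | no  _ = trans (Σ-mapMaybe Fs) (sym (ℤ.+-identityˡ _))

  -- The proof stored in a `Face` is irrelevant, so it can only be used to refute a negative
  -- decision.
  value-isFace : ∀ F → does (isFace? (value F)) ≡ true
  value-isFace (F ,ʳ [ p ]) with isFace? F
  ... | yes _ = refl
  ... | no ¬p = contradiction-irr p ¬p

  -- Facehood is a guard on a sum over all subsets: double sums then have a fixed index set and can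
  -- be exchanged.
  starSum : Subset v → (Subset v → ℤ) → ℤ
  starSum F φ = Σ (allSubsets v) (λ H → ⟦ does (isFace? H) ⟧ ⟦ does (F ⊆? H) ⟧ φ H)

  starSum-cong : ∀ F {φ ψ} → (∀ H → φ H ≡ ψ H) → starSum F φ ≡ starSum F ψ
  starSum-cong F eq = Σ-cong (allSubsets v) λ H →
    cong (λ x → ⟦ does (isFace? H) ⟧ ⟦ does (F ⊆? H) ⟧ x) (eq H)

  starSum-+ : ∀ F φ ψ → starSum F (λ H → φ H + ψ H) ≡ starSum F φ + starSum F ψ
  starSum-+ F φ ψ = trans
    (Σ-cong (allSubsets v) λ H → trans
      (cong (⟦ does (isFace? H) ⟧_) (⟦⟧-+ (does (F ⊆? H)) (φ H) (ψ H)))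
      (⟦⟧-+ (does (isFace? H)) (⟦ does (F ⊆? H) ⟧ φ H) (⟦ does (F ⊆? H) ⟧ ψ H)))
    (Σ-+ (allSubsets v) _ _)

  starSum-* : ∀ F c φ → starSum F (λ H → c * φ H) ≡ c * starSum F φ
  starSum-* F c φ = trans
    (Σ-cong (allSubsets v) λ H → sym (trans
      (⟦⟧-*ˡ (does (isFace? H)) c (⟦ does (F ⊆? H) ⟧ φ H))
      (cong (⟦ does (isFace? H) ⟧_) (⟦⟧-*ˡ (does (F ⊆? H)) c (φ H)))))
    (Σ-* (allSubsets v) c (λ H → ⟦ does (isFace? H) ⟧ ⟦ does (F ⊆? H) ⟧ φ H))

  starSum-⟦⟧ : ∀ F c φ → starSum F (λ H → ⟦ c ⟧ φ H) ≡ ⟦ c ⟧ starSum F φ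
  starSum-⟦⟧ F true  φ = refl
  starSum-⟦⟧ F false φ = trans
    (Σ-cong (allSubsets v) λ H → trans
      (cong (⟦ does (isFace? H) ⟧_) (⟦⟧-zero (does (F ⊆? H)))) (⟦⟧-zero (does (isFace? H))))
    (Σ-zero (allSubsets v))

  -- Among the faces containing `F`, only `F` has its cardinality. A quantity belonging to `F` alone
  -- can thus be written as a sum over the star.
  starSum-self : ∀ (F : Face) x → starSum (value F) (λ H → ⟦ does (rank Δ F ℕ.≟ card H) ⟧ x) ≡ x
  starSum-self F x = trans (Σ-cong (allSubsets v) only) (Σ-≡ (value F) (λ _ → x))
    where
    only : ∀ H → ⟦ does (isFace? H) ⟧ ⟦ does (value F ⊆? H) ⟧ ⟦ does (rank Δ F ℕ.≟ card H) ⟧ x ≡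
                 ⟦ does (Vec.≡-dec Bool._≟_ (value F) H) ⟧ x
    only H with value F ⊆? H
    ... | no F⊈H = trans (⟦⟧-zero (does (isFace? H)))
      (cong (λ c → ⟦ c ⟧ x) (sym (dec-false (Vec.≡-dec Bool._≟_ (value F) H) λ { refl → F⊈H ⊆-refl })))
    ... | yes F⊆H with Vec.≡-dec Bool._≟_ (value F) H
    ...   | yes refl = trans (cong (λ c → ⟦ c ⟧ ⟦ does (card H ℕ.≟ card H) ⟧ x) (value-isFace F))
                             (cong (λ c → ⟦ c ⟧ x) (dec-true (card H ℕ.≟ card H) refl))
    ...   | no F≢H = trans
      (cong (λ c → ⟦ does (isFace? H) ⟧ ⟦ c ⟧ x)
            (dec-false (rank Δ F ℕ.≟ card H) (F≢H ∘ ⊆∧∣∣≡⇒≡ (value F) H F⊆H)))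
      (⟦⟧-zero (does (isFace? H)))

  χ̃-link-starSum : ∀ F → χ̃-link Δ F ≡ starSum (value F) (λ H → -1ℤ ^ suc (card H ∸ rank Δ F))
  χ̃-link-starSum F = begin
    χ̃-link Δ F
      ≡⟨ foldr-Σ (filter (λ H → value F ⊆? value H) (faces Δ)) ⟩
    Σ (filter (λ H → value F ⊆? value H) (faces Δ)) (λ H → -1ℤ ^ suc (rank Δ H ∸ rank Δ F))
      ≡⟨ Σ-filter (λ H → value F ⊆? value H) (faces Δ) _ ⟩
    Σ (faces Δ) (λ H → ⟦ does (value F ⊆? value H) ⟧ (-1ℤ ^ suc (rank Δ H ∸ rank Δ F)))
      ≡⟨ Σ-faces (λ H → ⟦ does (value F ⊆? H) ⟧ (-1ℤ ^ suc (card H ∸ rank Δ F))) ⟩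
    starSum (value F) (λ H → -1ℤ ^ suc (card H ∸ rank Δ F))  ∎
    where
    foldr-Σ : ∀ Hs → foldr _+_ 0ℤ (map (λ H → -1ℤ ^ suc (rank Δ H ∸ rank Δ F)) Hs) ≡
                     Σ Hs (λ H → -1ℤ ^ suc (rank Δ H ∸ rank Δ F))
    foldr-Σ []       = refl
    foldr-Σ (H ∷ Hs) = cong (λ s → -1ℤ ^ suc (rank Δ H ∸ rank Δ F) + s) (foldr-Σ Hs)

  -- Every set between F and a face H is a face, so the inner sums range over Boolean intervals.
  starSum-starSum : ∀ F (φ : ℕ → ℕ → ℤ) →
    starSum F (λ G → starSum G (λ H → φ (card H) (card G))) ≡
    starSum F (λ H → binomialSum (φ (card H)) (card H ∸ card F) (card F))
  starSum-starSum F φ = begin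
    Σ (allSubsets v) (λ G → ⟦ does (isFace? G) ⟧ ⟦ does (F ⊆? G) ⟧
      Σ (allSubsets v) (λ H → ⟦ does (isFace? H) ⟧ ⟦ does (G ⊆? H) ⟧ φ (card H) (card G)))
      ≡⟨ Σ-cong (allSubsets v) (λ G → trans
           (cong (⟦ does (isFace? G) ⟧_) (sym (Σ-⟦⟧ (allSubsets v) (does (F ⊆? G)) _)))
           (sym (Σ-⟦⟧ (allSubsets v) (does (isFace? G)) _))) ⟩
    Σ (allSubsets v) (λ G → Σ (allSubsets v) (λ H → ⟦ does (isFace? G) ⟧ ⟦ does (F ⊆? G) ⟧
      ⟦ does (isFace? H) ⟧ ⟦ does (G ⊆? H) ⟧ φ (card H) (card G)))
      ≡⟨ Σ-swap (allSubsets v) (allSubsets v) _ ⟩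
    Σ (allSubsets v) (λ H → Σ (allSubsets v) (λ G → ⟦ does (isFace? G) ⟧ ⟦ does (F ⊆? G) ⟧
      ⟦ does (isFace? H) ⟧ ⟦ does (G ⊆? H) ⟧ φ (card H) (card G)))
      ≡⟨ Σ-cong (allSubsets v) (λ H → trans
           (Σ-cong (allSubsets v) (λ G → reorder G H (φ (card H) (card G))))
           (trans (Σ-⟦⟧ (allSubsets v) (does (isFace? H)) _)
                  (cong (⟦ does (isFace? H) ⟧_) (Σ-interval F H (φ (card H)))))) ⟩
    starSum F (λ H → binomialSum (φ (card H)) (card H ∸ card F) (card F))  ∎
    where
    reorder : ∀ G H x →
      ⟦ does (isFace? G) ⟧ ⟦ does (F ⊆? G) ⟧ ⟦ does (isFace? H) ⟧ ⟦ does (G ⊆? H) ⟧ x ≡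
      ⟦ does (isFace? H) ⟧ ⟦ does (F ⊆? G) ⟧ ⟦ does (G ⊆? H) ⟧ x
    reorder G H x with isFace? H | G ⊆? H
    -- Closure under subsets discharges the guard on `G`.
    ... | yes H∈Δ | yes G⊆H rewrite dec-true (isFace? G) (down-closed G⊆H H∈Δ) = refl
    ... | yes _   | no  _   = trans (cong (⟦ does (isFace? G) ⟧_) (⟦⟧-zero (does (F ⊆? G))))
      (trans (⟦⟧-zero (does (isFace? G))) (sym (⟦⟧-zero (does (F ⊆? G)))))
    ... | no  _   | _       = trans (cong (⟦ does (isFace? G) ⟧_) (⟦⟧-zero (does (F ⊆? G))))
      (⟦⟧-zero (does (isFace? G)))

  -- Chains in the face poset of the semisuspension.

  module _ (n : ℕ) (dim<n : (Dim< n) Δ) where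
    open Semisuspension Δ n dim<n

    open QuasiGradedPoset facePoset using (_⊏?_)

    linkTerm : ℕ → Element → Word → Element → ℤ
    linkTerm m x w z = ⟦ does (x ⊏? z) ⟧ (link-weight facePoset x z *ₚ 𝐛 ▷ chainSum facePoset m z top) w

    chainSum-split : ∀ m x w → chainSum facePoset (suc m) x top w ≡
      linkTerm m x w ∗ + (linkTerm m x w top + Σ (faces Δ) (linkTerm m x w ∘ face))
    chainSum-split m x w = trans (chainSum-suc facePoset m x top w)
      (cong (λ s → linkTerm m x w ∗ + (linkTerm m x w top + s)) (Σ-map face (faces Δ) (linkTerm m x w)))

    chainSum-top : ∀ m w → chainSum facePoset m top top w ≡ 0ℤ
    chainSum-top zero    w = refl
    chainSum-top (suc m) w = begin
      chainSum facePoset (suc m) top top w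
        ≡⟨ chainSum-split m top w ⟩
      0ℤ + (0ℤ + Σ (faces Δ) (λ _ → 0ℤ))
        ≡⟨ cong (λ s → 0ℤ + (0ℤ + s)) (Σ-zero (faces Δ)) ⟩
      0ℤ  ∎

    -- `top` is enumerated among the candidates for the first interior element, but no chain climbs
    -- strictly from `top` to `top`.
    link-▷-top : ∀ x m w → (link-weight facePoset x top *ₚ 𝐛 ▷ chainSum facePoset m top top) w ≡ 0ℤ
    link-▷-top x m w = trans
      (▷-cong (link-weight facePoset x top *ₚ 𝐛) (chainSum-top m) w)
      (▷-zero (link-weight facePoset x top *ₚ 𝐛) w)

    chainSum-∗ : ∀ m w → chainSum facePoset m ∗ top w ≡ afterApex n m w
    chainSum-∗ zero    w = ℤ.+-identityʳ _
    chainSum-∗ (suc m) w = begin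
      chainSum facePoset (suc m) ∗ top w
        ≡⟨ chainSum-split m ∗ w ⟩
      0ℤ + ((link-weight facePoset ∗ top *ₚ 𝐛 ▷ chainSum facePoset m top top) w + Σ (faces Δ) (λ _ → 0ℤ))
        ≡⟨ cong₂ (λ s t → 0ℤ + (s + t)) (link-▷-top ∗ m w) (Σ-zero (faces Δ)) ⟩
      0ℤ  ∎

    ζ-starSum : ∀ F → ζ (face F) ∗ ≡ starSum (value F) (λ H → apexCoeff n (rank Δ F) (card H))
    ζ-starSum F = sym (begin
      starSum (value F) (λ H → apexCoeff n (rank Δ F) (card H))
        ≡⟨ starSum-+ (value F) _ _ ⟩
      starSum (value F) (λ H → ⟦ does (rank Δ F ℕ.≟ card H) ⟧ 1ℤ) +
      starSum (value F) (λ H → (-1ℤ ^ (n ∸ rank Δ F)) * (-1ℤ ^ suc (card H ∸ rank Δ F)))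
        ≡⟨ cong₂ _+_ (starSum-self F 1ℤ)
                     (trans (starSum-* (value F) (-1ℤ ^ (n ∸ rank Δ F)) _)
                            (cong ((-1ℤ ^ (n ∸ rank Δ F)) *_) (sym (χ̃-link-starSum F)))) ⟩
      1ℤ + (-1ℤ ^ (n ∸ rank Δ F)) * χ̃-link Δ F  ∎)

    1·-*ₚ-▷ : ∀ p q f w → ((1ℤ · p) *ₚ q ▷ f) w ≡ (p *ₚ q ▷ f) w
    1·-*ₚ-▷ p q f w = trans (·-*ₚ-▷ 1ℤ p q f w) (ℤ.*-identityˡ _)

    apexTerm : ∀ m F w →
      linkTerm m (face F) w ∗ ≡
      starSum (value F) (λ H → ⟦ does (rank Δ F ℕ.<? n) ⟧
        (apexCoeff n (rank Δ F) (card H) * (link (n ∸ rank Δ F ∸ 1) ▷ afterApex n m) w))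
    apexTerm m F w = begin
      -- The factor `true` is the test that `face F` differs from `∗`.
      ⟦ does (rank Δ F ℕ.<? n) ∧ true ⟧ (link-weight facePoset (face F) ∗ *ₚ 𝐛 ▷ chainSum facePoset m ∗ top) w
        ≡⟨ cong₂ ⟦_⟧_ (Bool.∧-identityʳ (does (rank Δ F ℕ.<? n))) (begin
             ((ζ (face F) ∗ · D) *ₚ 𝐛 ▷ chainSum facePoset m ∗ top) w
               ≡⟨ ▷-cong ((ζ (face F) ∗ · D) *ₚ 𝐛) (chainSum-∗ m) w ⟩
             ((ζ (face F) ∗ · D) *ₚ 𝐛 ▷ afterApex n m) w
               ≡⟨ ·-*ₚ-▷ (ζ (face F) ∗) D 𝐛 (afterApex n m) w ⟩
             ζ (face F) ∗ * L
               ≡⟨ cong (_* L) (ζ-starSum F) ⟩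
             starSum (value F) (λ H → apexCoeff n (rank Δ F) (card H)) * L
               ≡⟨ ℤ.*-comm _ L ⟩
             L * starSum (value F) (λ H → apexCoeff n (rank Δ F) (card H))
               ≡⟨ starSum-* (value F) L _ ⟨
             starSum (value F) (λ H → L * apexCoeff n (rank Δ F) (card H))
               ≡⟨ starSum-cong (value F) (λ H → ℤ.*-comm L (apexCoeff n (rank Δ F) (card H))) ⟩
             starSum (value F) (λ H → apexCoeff n (rank Δ F) (card H) * L)  ∎) ⟩
      ⟦ does (rank Δ F ℕ.<? n) ⟧ starSum (value F) (λ H → apexCoeff n (rank Δ F) (card H) * L)
        ≡⟨ starSum-⟦⟧ (value F) (does (rank Δ F ℕ.<? n)) _ ⟨
      starSum (value F) (λ H → ⟦ does (rank Δ F ℕ.<? n) ⟧ (apexCoeff n (rank Δ F) (card H) * L))  ∎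
      where
      D : ℤ⟨a,b⟩
      D = (𝐚 -ₚ 𝐛) ^ₚ (n ∸ rank Δ F ∸ 1)

      L : ℤ
      L = (link (n ∸ rank Δ F ∸ 1) ▷ afterApex n m) w

    -- Induction on `m`, by the first interior element. The apex contributes through the expansion
    -- of ζ̄, `top` contributes nothing, and for a face `G` the hypothesis gives a sum over the
    -- faces above `G`, which `starSum-starSum` regroups by the larger face `H`.
    chainSum-face : ∀ m F w →
      chainSum facePoset m (face F) top w ≡ starSum (value F) (λ H → kernel n m (rank Δ F) (card H) w)
    chainSum-face zero F w = trans (ℤ.+-identityʳ _)
      (sym (starSum-self F (coeff (1ℤ · (𝐚 -ₚ 𝐛) ^ₚ (suc n ∸ rank Δ F ∸ 1)) w)))
    chainSum-face (suc m) F w = begin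
      chainSum facePoset (suc m) (face F) top w
        ≡⟨ chainSum-split m (face F) w ⟩
      linkTerm m (face F) w ∗ + (linkTerm m (face F) w top + Σ (faces Δ) (linkTerm m (face F) w ∘ face))
        ≡⟨ cong₂ _+_ (apexTerm m F w) (cong₂ _+_ (link-▷-top (face F) m w)
             (trans (Σ-cong (faces Δ) faceTerm) (Σ-faces (λ G → ⟦ does (value F ⊆? G) ⟧ inner G)))) ⟩
      starSum (value F) apex + (0ℤ + starSum (value F) inner)
        ≡⟨ cong (λ s → starSum (value F) apex + s)
             (trans (ℤ.+-identityˡ _) (starSum-starSum (value F) (λ h → kernelStep n m (rank Δ F) h w))) ⟩
      starSum (value F) apex +
      starSum (value F) (λ H → binomialSum (kernelStep n m (rank Δ F) (card H) w) (card H ∸ rank Δ F) (rank Δ F))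
        ≡⟨ starSum-+ (value F) _ _ ⟨
      starSum (value F) (λ H → kernel n (suc m) (rank Δ F) (card H) w)  ∎
      where
      apex inner : Subset v → ℤ
      apex H = ⟦ does (rank Δ F ℕ.<? n) ⟧
        (apexCoeff n (rank Δ F) (card H) * (link (n ∸ rank Δ F ∸ 1) ▷ afterApex n m) w)
      inner G = starSum G (λ H → kernelStep n m (rank Δ F) (card H) w (card G))

      faceTerm : ∀ G →
        linkTerm m (face F) w (face G) ≡
        ⟦ does (value F ⊆? value G) ⟧ inner (value G)
      -- The strict order test is a conjunction. Its first half stays as a guard and supplies the
      -- inclusion under which the second half becomes a comparison of ranks.
      faceTerm G = trans (Bool.if-∧ (does (value F ⊆? value G)))
        (⟦⟧-cong (does (value F ⊆? value G)) λ F⊆G → begin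
          ⟦ not (does (Vec.≡-dec Bool._≟_ (value F) (value G))) ⟧ X
            ≡⟨ cong (λ c → ⟦ not c ⟧ X) (⊆⇒does-≟ (from-does (value F ⊆? value G) F⊆G)) ⟩
          ⟦ not (does (rank Δ F ℕ.≟ rank Δ G)) ⟧ X
            ≡⟨ cong (⟦ not (does (rank Δ F ℕ.≟ rank Δ G)) ⟧_) (begin
                 X
                   ≡⟨ 1·-*ₚ-▷ ((𝐚 -ₚ 𝐛) ^ₚ e) 𝐛 (chainSum facePoset m (face G) top) w ⟩
                 (link e ▷ chainSum facePoset m (face G) top) w
                   ≡⟨ ▷-cong (link e) (chainSum-face m G) w ⟩
                 (link e ▷ (λ w → starSum (value G) (λ H → kernel n m (rank Δ G) (card H) w))) w
                   ≡⟨ ▷-starSum (link e) (value G) (λ H → kernel n m (rank Δ G) (card H)) ⟩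
                 starSum (value G) (λ H → (link e ▷ kernel n m (rank Δ G) (card H)) w)  ∎) ⟩
          ⟦ not (does (rank Δ F ℕ.≟ rank Δ G)) ⟧
            starSum (value G) (λ H → (link e ▷ kernel n m (rank Δ G) (card H)) w)
            ≡⟨ starSum-⟦⟧ (value G) (not (does (rank Δ F ℕ.≟ rank Δ G))) _ ⟨
          inner (value G)  ∎)
        where
        e : ℕ
        e = rank Δ G ∸ rank Δ F ∸ 1

        X : ℤ
        X = (link-weight facePoset (face F) (face G) *ₚ 𝐛 ▷ chainSum facePoset m (face G) top) w

        from-does : ∀ {P : Set} (P? : Dec P) → does P? ≡ true → P
        from-does (yes p) _ = p

        ▷-starSum : ∀ p G (f : Subset v → Word → ℤ) →
          (p ▷ (λ w → starSum G (λ H → f H w))) w ≡ starSum G (λ H → (p ▷ f H) w)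
        ▷-starSum p G f = trans (▷-Σ p (allSubsets v) _ w)
          (Σ-cong (allSubsets v) λ H → trans
            (▷-⟦⟧ p (does (isFace? H)) (λ w → ⟦ does (G ⊆? H) ⟧ f H w) w)
            (cong (⟦ does (isFace? H) ⟧_) (▷-⟦⟧ p (does (G ⊆? H)) (f H) w)))

    coeff-Ψ-facePoset : .{{_ : NonZero n}} → ∀ w → coeff (Ψ facePoset bounded) w ≡
      Σ (allSubsets v) (λ H → ⟦ does (isFace? H) ⟧ Σ (upTo (suc n)) (λ m → kernel n m 0 (card H) w))
    coeff-Ψ-facePoset w = begin
      coeff (Ψ facePoset bounded) w
        ≡⟨ coeff-Ψ facePoset bounded w ⟩
      Σ (upTo (suc n ∸ card (∅ {v}))) (λ m → chainSum facePoset m (face ∅-face) top w)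
        ≡⟨ Σ-cong (upTo (suc n ∸ card (∅ {v}))) (λ m → chainSum-face m ∅-face w) ⟩
      Σ (upTo (suc n ∸ card (∅ {v}))) (λ m → starSum ∅ (λ H → kernel n m (card (∅ {v})) (card H) w))
        -- For variable `v` the cardinality of `∅` is 0 only propositionally; the range and the
        -- starting rank are rewritten together.
        ≡⟨ cong (λ f → Σ (upTo (suc n ∸ f)) (λ m → starSum ∅ (λ H → kernel n m f (card H) w))) (∣⊥∣≡0 v) ⟩
      Σ (upTo (suc n)) (λ m → starSum ∅ (λ H → kernel n m 0 (card H) w))
        ≡⟨ Σ-swap (upTo (suc n)) (allSubsets v) _ ⟩
      Σ (allSubsets v) (λ H → Σ (upTo (suc n)) (λ m →
        ⟦ does (isFace? H) ⟧ ⟦ does (∅ ⊆? H) ⟧ kernel n m 0 (card H) w))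
        ≡⟨ Σ-cong (allSubsets v) (λ H → trans
             (Σ-⟦⟧ (upTo (suc n)) (does (isFace? H)) _)
             (cong (⟦ does (isFace? H) ⟧_) (Σ-cong (upTo (suc n)) λ m →
               cong (λ c → ⟦ c ⟧ kernel n m 0 (card H) w) (dec-true (∅ ⊆? H) ⊥⊆)))) ⟩
      Σ (allSubsets v) (λ H → ⟦ does (isFace? H) ⟧ Σ (upTo (suc n)) (λ m → kernel n m 0 (card H) w))  ∎

-- Simplicial shelling components

-- A set lies in the facet opposite `u` exactly when it misses `u`, so it is a face exactly when it
-- misses some vertex of `A`.
generatedBy-isFace : ∀ {k} (A : Subset (suc k)) A≠∅ F →
  does (SimplicialComplex.isFace? (generatedBy A A≠∅) F) ≡ not (does (A ⊆? F))
generatedBy-isFace A A≠∅ F = does-⇔ (mk⇔ avoids misses) (isFace? F) (¬? (A ⊆? F))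
  where
  open SimplicialComplex (generatedBy A A≠∅)

  avoids : IsFace F → ¬ A ⊆ F
  avoids (u , u∈A , F⊆) A⊆F = x∈∁p⇒x∉p (F⊆ (A⊆F u∈A)) (x∈⁅x⁆ u)

  misses : ¬ A ⊆ F → IsFace F
  -- Decidability of facehood and of membership replaces the search for a missed vertex.
  misses A⊈F = decidable-stable (isFace? F) λ ¬face → A⊈F λ {u} u∈A →
    decidable-stable (u ∈? F) λ u∉F → ¬face
      (u , u∈A , λ {x} x∈F → x∉p⇒x∈∁p λ x∈⁅u⁆ → u∉F (subst (_∈ F) (x∈⁅y⁆⇒x≡y u x∈⁅u⁆) x∈F))

faceWeight : ℕ → Word → ℕ → ℤ
faceWeight n w h = Σ (upTo (suc n)) (λ m → kernel n m 0 h w)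

module _ (S : FacetSelection) (n : ℕ) .{{_ : NonZero n}} (w : Word) where
  open FacetSelection S

  private
    β : ℕ → ℕ → ℤ
    β = binomialSum (faceWeight n w)

  -- The faces are all subsets of the vertex set except those containing the selection `V`. Only the
  -- size of `V` enters, so the choice of facets does not affect the result.
  coeff-ΨP : ∀ k i (i≤k : i ≤ k) (k≤n : k ≤ n) →
    coeff (ΨP S n k i i≤k k≤n) w ≡ β (suc k) 0 - β (k ∸ i) (suc i)
  coeff-ΨP k i i≤k k≤n = begin
    coeff (ΨP S n k i i≤k k≤n) w
      ≡⟨ coeff-Ψ-facePoset (Δ[_,_] S k i i≤k) n (Δ-dim S i≤k k≤n) w ⟩
    Σ (allSubsets (suc k)) (λ F → ⟦ does (SimplicialComplex.isFace? (Δ[_,_] S k i i≤k) F) ⟧ g F)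
      ≡⟨ Σ-cong (allSubsets (suc k)) (λ F → trans
           (cong (λ c → ⟦ c ⟧ g F) (generatedBy-isFace V (∣∣≡suc⇒Nonempty V (size i≤k)) F))
           (complement (does (V ⊆? F)) (g F))) ⟩
    Σ (allSubsets (suc k)) (λ F → g F - ⟦ does (V ⊆? F) ⟧ g F)
      ≡⟨ Σ-+ (allSubsets (suc k)) g (λ F → - ⟦ does (V ⊆? F) ⟧ g F) ⟩
    Σ (allSubsets (suc k)) g + Σ (allSubsets (suc k)) (λ F → - ⟦ does (V ⊆? F) ⟧ g F)
      ≡⟨ cong₂ _+_ (Σ-all (suc k) (faceWeight n w)) (trans
           (Σ-neg (allSubsets (suc k)) (λ F → ⟦ does (V ⊆? F) ⟧ g F))
           (cong -_ (Σ-⊇ V (faceWeight n w)))) ⟩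
    β (suc k) 0 - β (suc k ∸ card V) (card V)
      ≡⟨ cong (λ s → β (suc k) 0 - β (suc k ∸ s) s) (size i≤k) ⟩
    β (suc k) 0 - β (k ∸ i) (suc i)  ∎
    where
    V : Subset (suc k)
    V = select k i

    g : Subset (suc k) → ℤ
    g F = faceWeight n w (card F)

    complement : ∀ c x → ⟦ not c ⟧ x ≡ x - ⟦ c ⟧ x
    complement true  x = sym (ℤ.+-inverseʳ x)
    complement false x = sym (ℤ.+-identityʳ x)

  -- The faces of Δ_{k,i} outside Δ_{k,i-1} contain i prescribed vertices and avoid another one.
  coeff-Φ̌ : ∀ k i (i≤k : i ≤ k) (k≤n : k ≤ n) → coeff (Φ̌ S n k i i≤k k≤n) w ≡ β (k ∸ i) i
  -- Here `β (suc k) 0` computes to `β k 0 + β k 1`.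
  coeff-Φ̌ k zero    i≤k k≤n = trans (coeff-ΨP k 0 i≤k k≤n) (cancel (β k 0) (β k 1))
    where
    cancel : ∀ x y → x + y - y ≡ x
    cancel = solve-∀
  coeff-Φ̌ k (suc i) i<k k≤n = begin
    coeff (ΨP S n k (suc i) i<k k≤n -ₚ ΨP S n k i i≤k k≤n) w
      ≡⟨ coeff--ₚ (ΨP S n k (suc i) i<k k≤n) (ΨP S n k i i≤k k≤n) w ⟩
    coeff (ΨP S n k (suc i) i<k k≤n) w - coeff (ΨP S n k i i≤k k≤n) w
      ≡⟨ cong₂ _-_ (coeff-ΨP k (suc i) i<k k≤n) (coeff-ΨP k i i≤k k≤n) ⟩
    β (suc k) 0 - β m (suc (suc i)) - (β (suc k) 0 - β (k ∸ i) (suc i))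
      -- Since `i` is less than `k`, the difference `k ∸ i` is `suc m`, and the recurrence for `β`
      -- unfolds.
      ≡⟨ cong (λ l → β (suc k) 0 - β m (suc (suc i)) - (β (suc k) 0 - β l (suc i))) (ℕ.+-∸-assoc 1 i<k) ⟩
    β (suc k) 0 - β m (suc (suc i)) - (β (suc k) 0 - (β m (suc i) + β m (suc (suc i))))
      ≡⟨ cancel (β (suc k) 0) (β m (suc i)) (β m (suc (suc i))) ⟩
    β m (suc i)  ∎
    where
    m : ℕ
    m = k ∸ suc i

    i≤k : i ≤ k
    i≤k = ≤-trans (ℕ.n≤1+n i) i<k

    cancel : ∀ t x y → t - y - (t - (x + y)) ≡ x
    cancel = solve-∀

corollary14p5 : (S : FacetSelection) (n k i : ℕ) .{{_ : NonZero n}}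
    (i≤k : i ≤ k) (k≤n : k ≤ n) →
    Φ̌ S n k i i≤k k≤n ≈
    (∑[ j ∈ upTo (suc i) ] (((-1ℤ ^ j) * (+ (i C j))) · Φ̌ S n (k ∸ j) 0 z≤n (≤-trans (m∸n≤m k j) k≤n)))
corollary14p5 S n k i i≤k k≤n w = begin
  coeff (Φ̌ S n k i i≤k k≤n) w
    ≡⟨ coeff-Φ̌ S n w k i i≤k k≤n ⟩
  binomialSum (faceWeight n w) (k ∸ i) i
    ≡⟨ binomialSum-alternating (faceWeight n w) i (k ∸ i) ⟩
  alternatingSum i (λ j → binomialSum (faceWeight n w) (k ∸ i ℕ.+ i ∸ j) 0)
    -- The identity was applied with `k ∸ i` free points, and `k ∸ i + i` is `k` because `i ≤ k`.
    ≡⟨ cong (λ l → alternatingSum i (λ j → binomialSum (faceWeight n w) (l ∸ j) 0)) (ℕ.m∸n+n≡m i≤k) ⟩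
  alternatingSum i (λ j → binomialSum (faceWeight n w) (k ∸ j) 0)
    ≡⟨ Σ-cong (upTo (suc i)) (λ j → trans
         (coeff-· ((-1ℤ ^ j) * + (i C j)) (Φ̌₀ j) w)
         (cong (((-1ℤ ^ j) * + (i C j)) *_) (coeff-Φ̌ S n w (k ∸ j) 0 z≤n (≤-trans (m∸n≤m k j) k≤n)))) ⟨
  Σ (upTo (suc i)) (λ j → coeff (((-1ℤ ^ j) * + (i C j)) · Φ̌₀ j) w)
    ≡⟨ coeff-∑ (upTo (suc i)) (λ j → ((-1ℤ ^ j) * + (i C j)) · Φ̌₀ j) w ⟨
  coeff (∑[ j ∈ upTo (suc i) ] (((-1ℤ ^ j) * (+ (i C j))) · Φ̌₀ j)) w  ∎
  where
  Φ̌₀ : ℕ → ℤ⟨a,b⟩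
  Φ̌₀ j = Φ̌ S n (k ∸ j) 0 z≤n (≤-trans (m∸n≤m k j) k≤n)
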